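{- Let $m\ge 1$. Every deterministic online algorithm for obligatory-test scheduling on $m$ identical machines (objective: minimize $\sum_j C_j$) has an asymptotic competitive ratio of at least $$\rho := \max_{\substack{0\le \alpha\le \beta\\ \alpha+\beta\le 1}} \frac{\frac12+\alpha+\beta-\frac{\beta^2}{2}}{\frac12+\alpha^2+\alpha\beta+\frac{\beta^2}{2}} .$$ Numerically, $\rho \ge 1.4811$, attained at approximately $\alpha\approx 0.1939$, $\beta\approx 0.2873$.
   Context: Obligatory-test scheduling on $m$ identical parallel machines: a set of jobs $J=\{1,\dots,N\}$ is available at time $0$. Each job $j$ has a test operation $\tau_j$ of known length $t_j\ge 0$ and a processing operation $\pi_j$ of initially unknown length $p_j\ge 0$. The value $p_j$ is revealed to the algorithm only when $\tau_j$ completes. The operation $\pi_j$ cannot start before $\tau_j$ has completed; it may be executed on any machine (not necessarily the one that ran $\tau_j$) and need not start immediately after $\tau_j$. Each machine executes at most one operation at a time, operations are executed nonpreemptively, and idle time is allowed. The completion time $C_j$ is the time at which $\pi_j$ finishes, and all jobs must be completed. The objective is to minimize $\sum_{j\in J} C_j$. For an instance $I$, $\mathrm{ALG}(I)$ is the objective value of the online algorithm on $I$, and $\mathrm{OPT}(I)$ is the optimal objective value of an offline schedule, which knows all $p_j$ in advance. For a deterministic algorithm, the processing times may be chosen by an adaptive adversary when tests complete. The asymptotic competitive ratio of an algorithm (with $m$ fixed) is the limit superior, as the number of jobs $N\to\infty$, of the supremum of $\mathrm{ALG}(I)/\mathrm{OPT}(I)$ over instances $I$ with $N$ jobs (and $\mathrm{OPT}(I)>0$).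 -}

module Defs where

open import Level using (0ℓ)
open import Algebra.Bundles using (RawMonoid)
import Algebra.Definitions.RawMonoid as RawMonoidOps
open import Algebra.Structures using (IsCommutativeRing)
open import Data.Fin.Base using (Fin)
open import Data.Nat.Base as ℕ using (ℕ)
open import Data.Product.Base using (Σ; ∃; ∃-syntax; _×_)
open import Data.Sum.Base using (_⊎_)
import Relation.Binary.Construct.Add.Extrema.NonStrict as ExtendedOrder
import Relation.Binary.Construct.NonStrictToStrict as ToStrict
open import Relation.Binary.Core using (Rel)
open import Relation.Binary.PropositionalEquality.Core using (_≡_; _≢_)
open import Relation.Binary.Structures using (IsTotalOrder)
open import Relation.Nullary.Construct.Add.Extrema using (_±; [_])
open import Relation.Nullary.Negation.Core using (¬_)
open import Relation.Unary using (Pred)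

module Bounds {A : Set} (_≤_ : Rel A 0ℓ) where

  UpperBound LowerBound : Pred A 0ℓ → Pred A 0ℓ
  UpperBound P u = ∀ x → P x → x ≤ u
  LowerBound P l = ∀ x → P x → l ≤ x

  IsSup IsInf IsMax : Pred A 0ℓ → Pred A 0ℓ
  IsSup P s = UpperBound P s × (∀ u → UpperBound P u → s ≤ u)
  IsInf P i = LowerBound P i × (∀ l → LowerBound P l → l ≤ i)
  IsMax P v = P v × UpperBound P v

-- The standard library has no real numbers; they are axiomatised as a
-- Dedekind-complete ordered field, which (classically) determines them up to
-- unique isomorphism.  The value of 0# ⁻¹ is unspecified.
record RealNumbers : Set₁ where
  infix  4 _≤_
  infixl 6 _+_
  infixl 7 _*_
  infix  8 -_
  infix  9 _⁻¹
  field
    ℝ       : Set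
    _+_ _*_ : ℝ → ℝ → ℝ
    -_ _⁻¹  : ℝ → ℝ
    0# 1#   : ℝ
    _≤_     : Rel ℝ 0ℓ

    isCommutativeRing : IsCommutativeRing _≡_ _+_ _*_ -_ 0# 1#
    0≢1               : 0# ≢ 1#
    ⁻¹-inverseʳ       : ∀ x → x ≢ 0# → x * x ⁻¹ ≡ 1#

    isTotalOrder : IsTotalOrder _≡_ _≤_
    +-monoʳ-≤    : ∀ z {x y} → x ≤ y → z + x ≤ z + y
    *-nonNeg     : ∀ {x y} → 0# ≤ x → 0# ≤ y → 0# ≤ x * y

    complete : (P : Pred ℝ 0ℓ) → ∃ P → ∃ (Bounds.UpperBound _≤_ P) →
               ∃ (Bounds.IsSup _≤_ P)

module Scheduling (R : RealNumbers) where

  open RealNumbers R public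
  open ToStrict _≡_ _≤_ public using (_<_)
  open ExtendedOrder _≤_ public using (_≤±_)

  module ℝ-Bounds  = Bounds _≤_
  module ℝ±-Bounds = Bounds _≤±_

  infixl 6 _-_
  infixl 7 _÷_

  _-_ _÷_ : ℝ → ℝ → ℝ
  x - y = x + (- y)
  x ÷ y = x * y ⁻¹

  +-rawMonoid : RawMonoid 0ℓ 0ℓ
  +-rawMonoid = record { Carrier = ℝ ; _≈_ = _≡_ ; _∙_ = _+_ ; ε = 0# }

  open RawMonoidOps +-rawMonoid public using (sum) renaming (_×_ to _·_)

  fromℕ : ℕ → ℝ
  fromℕ n = n · 1#

  frac : ℕ → ℕ → ℝ
  frac a b = fromℕ a ÷ fromℕ b

  record Instance (N : ℕ) : Set where
    field
      t p   : Fin N → ℝ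
      0≤t   : ∀ j → 0# ≤ t j
      0≤p   : ∀ j → 0# ≤ p j

  open Instance public

  data Operation (N : ℕ) : Set where
    τ π : Fin N → Operation N

  duration : ∀ {N} → Instance N → Operation N → ℝ
  duration I (τ j) = t I j
  duration I (π j) = p I j

  record Schedule (m N : ℕ) : Set where
    field
      start   : Operation N → ℝ
      machine : Operation N → Fin m

  open Schedule public

  finish : ∀ {m N} → Instance N → Schedule m N → Operation N → ℝ
  finish I S o = start S o + duration I o

  record Feasible {m N} (I : Instance N) (S : Schedule m N) : Set where
    field
      0≤start    : ∀ o → 0# ≤ start S o
      test-first : ∀ j → finish I S (τ j) ≤ start S (π j)
      disjoint   : ∀ {o o′} → o ≢ o′ → machine S o ≡ machine S o′ →
                   finish I S o ≤ start S o′ ⊎ finish I S o′ ≤ start S o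

  cost : ∀ {m N} → Instance N → Schedule m N → ℝ
  cost I S = sum λ j → finish I S (π j)

  IsOPT : ∀ (m : ℕ) {N} → Instance N → Pred ℝ 0ℓ
  IsOPT m {N} I = ℝ-Bounds.IsInf λ c →
    Σ (Schedule m N) λ S → Feasible I S × c ≡ cost I S

  SameAt : ∀ {m N} → Schedule m N → Schedule m N → Operation N → Set
  SameAt S S′ o = start S o ≡ start S′ o × machine S o ≡ machine S′ o

  -- A deterministic online algorithm is represented by the schedule it ends up
  -- producing on each instance.  It knows N and all t j from the beginning, so
  -- its runs on two instances with the same t coincide until a test, run
  -- identically in both, completes and reveals different processing times.
  -- Hence an operation o can be scheduled differently only if such a test has
  -- completed by the time o starts.  (Exchanging I and I′ gives the same bound
  -- for the start of o in the other run.)  If p agrees as well, the schedules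
  -- must agree, so the 0≤t and 0≤p components of an instance are irrelevant.
  NonAnticipating : ∀ {m} → (∀ {N} → Instance N → Schedule m N) → Set
  NonAnticipating run =
    ∀ {N} (I I′ : Instance N) → (∀ j → t I j ≡ t I′ j) →
    ∀ o → ¬ SameAt (run I) (run I′) o →
    ∃[ j ] p I j ≢ p I′ j
         × SameAt (run I) (run I′) (τ j)
         × finish I (run I) (τ j) ≤ start (run I) o

  record OnlineAlgorithm (m : ℕ) : Set where
    field
      run             : ∀ {N} → Instance N → Schedule m N
      feasible        : ∀ {N} (I : Instance N) → Feasible I (run I)
      nonAnticipating : NonAnticipating run

  open OnlineAlgorithm public

  ALG : ∀ {m N} → OnlineAlgorithm m → Instance N → ℝ
  ALG A I = cost I (run A I)

  IsLimSup : (ℕ → ℝ ±) → Pred (ℝ ±) 0ℓ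
  IsLimSup r L = Σ (ℕ → ℝ ±) λ s →
      (∀ n → ℝ±-Bounds.IsSup (λ x → ∃[ N ] n ℕ.≤ N × x ≡ r N) (s n))
    × ℝ±-Bounds.IsInf (λ x → ∃[ n ] x ≡ s n) L

  Ratio : ∀ {m} → OnlineAlgorithm m → ℕ → Pred (ℝ ±) 0ℓ
  Ratio {m} A N x = Σ (Instance N) λ I → ∃[ opt ]
    IsOPT m I opt × 0# < opt × x ≡ [ ALG A I ÷ opt ]

  IsAsymptoticRatio : ∀ {m} → OnlineAlgorithm m → Pred (ℝ ±) 0ℓ
  IsAsymptoticRatio A L = Σ (ℕ → ℝ ±) λ r →
    (∀ N → ℝ±-Bounds.IsSup (Ratio A N) (r N)) × IsLimSup r L

  ½ : ℝ
  ½ = frac 1 2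

  F : ℝ → ℝ → ℝ
  F α β = (½ + α + β - ½ * (β * β)) ÷ (½ + α * α + α * β + ½ * (β * β))

  Region : ℝ → ℝ → Set
  Region α β = 0# ≤ α × α ≤ β × α + β ≤ 1#

  Isρ : Pred ℝ 0ℓ
  Isρ = ℝ-Bounds.IsMax λ v → ∃[ α ] ∃[ β ] Region α β × v ≡ F α β

{-# OPTIONS --safe #-}

-- Write F = num ÷ den.  The form ρ den - num is a convex quadratic in (α , β)
-- whose minimum is 0 exactly when ρ³ + ρ² - 3ρ - 1 = 0.  At the root in
-- [1.48115 , 1.4812] it equals ½ (ρ x² + ρ (x + y)² + y²), where x and y are the
-- offsets from the critical point (1 / (ρ (ρ + 2)) , 1 / (ρ + 2)), so this point
-- maximises F, with value ρ.
--
-- For the lower bound an adversary simpler than the optimised one is enough, as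
-- it already forces the ratio 3/2 > ρ.  All 2n tests have length 1, the n jobs
-- tested first get p = 2 and the other n get p = 0.  Disjoint intervals of
-- lengths wᵢ starting at sᵢ ≥ a on m machines satisfy
--   Σ wᵢ (2 (sᵢ - a) + wᵢ) ≥ (Σ wᵢ)² / m.
-- Adding this inequality for all operations, for the tests of the short jobs and
-- (time-reversed) for the tests of the long jobs bounds the cost of any such
-- schedule below by (9/2) n² / m.  Running the short jobs first costs only
-- 3 n² / m + O(n).

module Submission where

open import Defs
open import Level using (0ℓ)
open import Algebra.Bundles using (CommutativeRing)
import Algebra.Properties.Ring as RingProperties
import Algebra.Properties.Semiring.Mult as Multiplication
import Algebra.Properties.Semiring.Sum as Summation
import Algebra.Solver.Ring as RingSolver
open import Algebra.Solver.Ring.AlmostCommutativeRing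
  using (fromCommutativeRing; _-Raw-AlmostCommutative⟶_)
open import Axiom.ExcludedMiddle using (ExcludedMiddle)
open import Data.Bool.Base using (true; false; if_then_else_)
open import Data.Fin.Base as Fin
  using (Fin; zero; suc; toℕ; _↑ˡ_; _↑ʳ_; splitAt; quotient; remainder; combine)
import Data.Fin.Permutation as Permutation
open import Data.Fin.Permutation
  using (Permutation′; _⟨$⟩ʳ_; _⟨$⟩ˡ_; _∘ₚ_; lift₀; transpose; inverseˡ; inverseʳ)
import Data.Fin.Properties as Fin
open import Data.Integer.Base as ℤ using (ℤ; -[1+_]; +-*-rawRing)
import Data.Integer.Properties as ℤ
import Data.Maybe.Base as Maybe
open import Data.Nat.Base as ℕ using (ℕ; zero; suc; NonZero; s≤s; z≤n)
import Data.Nat.Properties as ℕ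
open import Data.Product.Base using (Σ; ∃; ∃-syntax; _×_; _,_; proj₁; proj₂)
open import Data.Sum.Base as Sum using (_⊎_; inj₁; inj₂; [_,_]′)
open import Function.Base using (_∘_; _$_; case_of_)
open import Function.Bundles using (Injection)
open import Function.Properties.Inverse using (↔⇒↣)
open import Relation.Binary.Bundles using (Poset)
open import Relation.Binary.Consequences using (dec⇒weaklyDec)
open import Relation.Binary.Construct.Add.Extrema.NonStrict
  using ([_]; ⊥±≤_; _≤⊤±; [≤]-injective; ≤±-trans)
open import Relation.Binary.Construct.Add.Supremum.NonStrict
  using () renaming ([_] to [_]⁺)
open import Relation.Binary.Definitions using (tri<; tri≈; tri>)
open import Relation.Binary.PropositionalEquality.Core
  using (_≡_; _≢_; refl; sym; trans; cong; cong₂; subst; subst₂)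
open import Relation.Binary.PropositionalEquality.Properties using (module ≡-Reasoning)
import Relation.Binary.Reasoning.PartialOrder as PosetReasoning
open import Relation.Binary.Structures using (IsTotalOrder)
open import Relation.Nullary.Construct.Add.Extrema using (_±; ⊥±; ⊤±; [_])
open import Relation.Nullary.Decidable.Core using (yes; no; does)
open import Relation.Nullary.Negation.Core using (¬_; contradiction)
open import Relation.Unary using (Pred)

-- The cost charges only the starts of long processings and of short tests, each once. The
-- inequality over all operations weights a start by twice the length of its operation: 4 for long
-- processings, 2 for every test, 0 for short processings. It therefore undercounts the short tests
-- and also pays for the long tests, which the cost ignores. Being online repairs both: some time
-- `T` separates the two groups of tests, so the inequality for the short tests, measured from `T`,
-- supplies the missing weight, and the reversed one for the long tests cancels their starts. The
-- multiples of `T` introduced by the two are opposite, and weight 4 on everything charged remains.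
-- The offline schedule escapes because it tests in the opposite order. A limit superior needs large
-- ratios only for arbitrarily large `N`, so `N = 2 k m` is enough. The room between `ρ` and 3/2
-- then absorbs the lower-order term of the offline cost.

-- Ordered-field arithmetic and a ring solver with integer coefficients.

module OrderedField (R : RealNumbers) where

  open Scheduling R

  commutativeRing : CommutativeRing 0ℓ 0ℓ
  commutativeRing = record { isCommutativeRing = isCommutativeRing }

  open CommutativeRing commutativeRing public
    using (ring; semiring; +-assoc; +-comm; +-identityˡ; +-identityʳ;
           *-assoc; *-comm; *-identityˡ; *-identityʳ; zeroˡ; zeroʳ; -‿inverseʳ)
  open RingProperties ring public
    using (-‿distribˡ-*; -‿distribʳ-*; -‿involutive; -‿+-comm; -0#≈0#)
  open Multiplication semiring public using (×-homo-+; ×1-homo-*)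
  open Summation semiring public
    using (sum-cong-≗; ∑-distrib-+; ∑-comm; sum-permute; *-distribˡ-sum)

  fromℕ-+ : ∀ m n → fromℕ (m ℕ.+ n) ≡ fromℕ m + fromℕ n
  fromℕ-+ = ×-homo-+ 1#

  fromℕ-* : ∀ m n → fromℕ (m ℕ.* n) ≡ fromℕ m * fromℕ n
  fromℕ-* = ×1-homo-*

  -- The ring solver normalises coefficients by deciding their equality, so they are taken from the
  -- integers; the homomorphism laws below justify interpreting them in `ℝ`.
  fromℤ : ℤ → ℝ
  fromℤ (ℤ.+ n)    = fromℕ n
  fromℤ -[1+ n ] = - fromℕ (suc n)

  private
    cancel-1+ : ∀ x y → (1# + x) - (1# + y) ≡ x - y
    cancel-1+ x y = begin
      1# + x + - (1# + y)       ≡⟨ cong₂ _+_ (+-comm 1# x) (sym (-‿+-comm 1# y)) ⟩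
      x + 1# + (- 1# + - y)     ≡⟨ +-assoc x 1# _ ⟩
      x + (1# + (- 1# + - y))   ≡⟨ cong (x +_) (sym (+-assoc 1# _ _)) ⟩
      x + (1# + - 1# + - y)     ≡⟨ cong (λ z → x + (z + - y)) (-‿inverseʳ 1#) ⟩
      x + (0# + - y)            ≡⟨ cong (x +_) (+-identityˡ _) ⟩
      x - y                     ∎
      where open ≡-Reasoning

  fromℤ-⊖ : ∀ m n → fromℤ (m ℤ.⊖ n) ≡ fromℕ m - fromℕ n
  fromℤ-⊖ m       zero    = sym (trans (cong (fromℕ m +_) -0#≈0#) (+-identityʳ _))
  fromℤ-⊖ zero    (suc n) = sym (+-identityˡ _)
  fromℤ-⊖ (suc m) (suc n) = trans (cong fromℤ (ℤ.[1+m]⊖[1+n]≡m⊖n m n))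
    (trans (fromℤ-⊖ m n) (sym (cancel-1+ (fromℕ m) (fromℕ n))))

  fromℤ-neg : ∀ i → fromℤ (ℤ.- i) ≡ - fromℤ i
  fromℤ-neg (ℤ.+ zero)  = sym -0#≈0#
  fromℤ-neg (ℤ.+ suc n) = refl
  fromℤ-neg -[1+ n ]  = sym (-‿involutive _)

  fromℤ-+ : ∀ i j → fromℤ (i ℤ.+ j) ≡ fromℤ i + fromℤ j
  fromℤ-+ (ℤ.+ m)    (ℤ.+ n)    = fromℕ-+ m n
  fromℤ-+ (ℤ.+ m)    -[1+ n ] = fromℤ-⊖ m (suc n)
  fromℤ-+ -[1+ m ] (ℤ.+ n)    = trans (fromℤ-⊖ n (suc m)) (+-comm _ _)
  fromℤ-+ -[1+ m ] -[1+ n ] = begin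
    - fromℕ (suc (suc (m ℕ.+ n)))        ≡⟨ cong (-_ ∘ fromℕ) (ℕ.+-suc (suc m) n) ⟨
    - fromℕ (suc m ℕ.+ suc n)            ≡⟨ cong -_ (fromℕ-+ (suc m) (suc n)) ⟩
    - (fromℕ (suc m) + fromℕ (suc n))    ≡⟨ -‿+-comm _ _ ⟨
    - fromℕ (suc m) - fromℕ (suc n)      ∎
    where open ≡-Reasoning

  fromℤ-*ʳ : ∀ m j → fromℤ (ℤ.+ m ℤ.* j) ≡ fromℕ m * fromℤ j
  fromℤ-*ʳ m (ℤ.+ n) = trans (cong fromℤ (sym (ℤ.pos-* m n))) (fromℕ-* m n)
  fromℤ-*ʳ m -[1+ n ] = begin
    fromℤ (ℤ.+ m ℤ.* -[1+ n ])         ≡⟨ cong fromℤ (ℤ.neg-distribʳ-* (ℤ.+ m) (ℤ.+ suc n)) ⟨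
    fromℤ (ℤ.- (ℤ.+ m ℤ.* ℤ.+ suc n))  ≡⟨ fromℤ-neg (ℤ.+ m ℤ.* ℤ.+ suc n) ⟩
    - fromℤ (ℤ.+ m ℤ.* ℤ.+ suc n)      ≡⟨ cong -_ (fromℤ-*ʳ m (ℤ.+ suc n)) ⟩
    - (fromℕ m * fromℕ (suc n))        ≡⟨ -‿distribʳ-* _ _ ⟩
    fromℕ m * - fromℕ (suc n)          ∎
    where open ≡-Reasoning

  fromℤ-* : ∀ i j → fromℤ (i ℤ.* j) ≡ fromℤ i * fromℤ j
  fromℤ-* (ℤ.+ m)  j = fromℤ-*ʳ m j
  fromℤ-* -[1+ m ] j = begin
    fromℤ (-[1+ m ] ℤ.* j)           ≡⟨ cong fromℤ (ℤ.neg-distribˡ-* (ℤ.+ suc m) j) ⟨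
    fromℤ (ℤ.- (ℤ.+ suc m ℤ.* j))    ≡⟨ fromℤ-neg (ℤ.+ suc m ℤ.* j) ⟩
    - fromℤ (ℤ.+ suc m ℤ.* j)        ≡⟨ cong -_ (fromℤ-*ʳ (suc m) j) ⟩
    - (fromℕ (suc m) * fromℤ j)      ≡⟨ -‿distribˡ-* _ _ ⟩
    - fromℕ (suc m) * fromℤ j        ∎
    where open ≡-Reasoning

  private
    ℤ⟶ℝ : +-*-rawRing -Raw-AlmostCommutative⟶ fromCommutativeRing commutativeRing
    ℤ⟶ℝ = record
      { ⟦_⟧    = fromℤ
      ; +-homo = fromℤ-+
      ; *-homo = fromℤ-*
      ; -‿homo = fromℤ-neg
      ; 0-homo = refl
      ; 1-homo = +-identityʳ 1#
      }

  open RingSolver +-*-rawRing (fromCommutativeRing commutativeRing) ℤ⟶ℝ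
    (λ i j → Maybe.map (cong fromℤ) (dec⇒weaklyDec ℤ._≟_ i j)) public
    using (solve; _:=_; _:+_; _:*_; _:-_; :-_; con; Polynomial)

  -- Denotes `fromℕ k` definitionally. As `fromℕ 1` unfolds to `1# + 0#`, constants in solver
  -- identities are written `fromℕ 1`, `fromℕ 2` and so on.
  nat : ∀ {n} → ℕ → Polynomial n
  nat k = con (ℤ.+ k)

  open IsTotalOrder isTotalOrder public
    using () renaming (trans to ≤-trans; antisym to ≤-antisym; total to ≤-total;
                       reflexive to ≤-reflexive; refl to ≤-refl)

  ≤-poset : Poset 0ℓ 0ℓ 0ℓ
  ≤-poset = record
    { isPartialOrder = IsTotalOrder.isPartialOrder isTotalOrder }

  module ≤-Reasoning where
    open PosetReasoning ≤-poset public hiding (start)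

  -- The pattern behind the polynomial inequalities: the slack `d` is given in a visibly nonnegative
  -- form and the solver checks the identity.
  ≤-by : ∀ {x y} d → 0# ≤ d → x + d ≡ y → x ≤ y
  ≤-by {x} {y} d 0≤d x+d≡y = begin
    x       ≡⟨ +-identityʳ x ⟨
    x + 0#  ≤⟨ +-monoʳ-≤ x 0≤d ⟩
    x + d   ≡⟨ x+d≡y ⟩
    y       ∎
    where open ≤-Reasoning

  x≤y⇒0≤y-x : ∀ {x y} → x ≤ y → 0# ≤ y - x
  x≤y⇒0≤y-x {x} {y} x≤y = begin
    0#        ≡⟨ solve 1 (λ x → nat 0 := :- x :+ x) refl x ⟩
    - x + x   ≤⟨ +-monoʳ-≤ (- x) x≤y ⟩
    - x + y   ≡⟨ +-comm _ _ ⟩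
    y - x     ∎
    where open ≤-Reasoning

  0≤y-x⇒x≤y : ∀ {x y} → 0# ≤ y - x → x ≤ y
  0≤y-x⇒x≤y {x} {y} p = ≤-by (y - x) p (solve 2 (λ x y → x :+ (y :- x) := y) refl x y)

  +-mono-≤ : ∀ {x y u v} → x ≤ y → u ≤ v → x + u ≤ y + v
  +-mono-≤ {x} {y} {u} {v} x≤y u≤v = begin
    x + u  ≤⟨ +-monoʳ-≤ x u≤v ⟩
    x + v  ≡⟨ +-comm x v ⟩
    v + x  ≤⟨ +-monoʳ-≤ v x≤y ⟩
    v + y  ≡⟨ +-comm v y ⟩
    y + v  ∎
    where open ≤-Reasoning

  +-nonNeg : ∀ {x y} → 0# ≤ x → 0# ≤ y → 0# ≤ x + y
  +-nonNeg {x} {y} p q = subst (_≤ x + y) (+-identityˡ 0#) (+-mono-≤ p q)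

  +-cancelˡ-≤ : ∀ z {x y} → z + x ≤ z + y → x ≤ y
  +-cancelˡ-≤ z {x} {y} p = 0≤y-x⇒x≤y $ subst (0# ≤_)
    (solve 3 (λ x y z → (z :+ y) :- (z :+ x) := y :- x) refl x y z) (x≤y⇒0≤y-x p)

  neg-mono-≤ : ∀ {x y} → x ≤ y → - y ≤ - x
  neg-mono-≤ {x} {y} p = ≤-by (y - x) (x≤y⇒0≤y-x p)
    (solve 2 (λ x y → :- y :+ (y :- x) := :- x) refl x y)

  *-monoʳ-≤ : ∀ {z x y} → 0# ≤ z → x ≤ y → z * x ≤ z * y
  *-monoʳ-≤ {z} {x} {y} 0≤z x≤y = ≤-by (z * (y - x)) (*-nonNeg 0≤z (x≤y⇒0≤y-x x≤y))
    (solve 3 (λ x y z → z :* x :+ z :* (y :- x) := z :* y) refl x y z)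

  *-mono-≤ : ∀ {x y u v} → 0# ≤ x → 0# ≤ v → x ≤ y → u ≤ v → x * u ≤ y * v
  *-mono-≤ {x} {y} {u} {v} 0≤x 0≤v x≤y u≤v = begin
    x * u  ≤⟨ *-monoʳ-≤ 0≤x u≤v ⟩
    x * v  ≡⟨ *-comm x v ⟩
    v * x  ≤⟨ *-monoʳ-≤ 0≤v x≤y ⟩
    v * y  ≡⟨ *-comm v y ⟩
    y * v  ∎
    where open ≤-Reasoning

  0≤x² : ∀ x → 0# ≤ x * x
  0≤x² x with ≤-total 0# x
  ... | inj₁ 0≤x = *-nonNeg 0≤x 0≤x
  ... | inj₂ x≤0 = subst (0# ≤_) (solve 1 (λ x → (nat 0 :- x) :* (nat 0 :- x) := x :* x) refl x)
                     (*-nonNeg (x≤y⇒0≤y-x x≤0) (x≤y⇒0≤y-x x≤0))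

  0≤1 : 0# ≤ 1#
  0≤1 = subst (0# ≤_) (*-identityˡ 1#) (0≤x² 1#)

  0≤fromℕ : ∀ n → 0# ≤ fromℕ n
  0≤fromℕ zero    = ≤-refl
  0≤fromℕ (suc n) = +-nonNeg 0≤1 (0≤fromℕ n)

  fromℕ-mono-≤ : ∀ {m n} → m ℕ.≤ n → fromℕ m ≤ fromℕ n
  fromℕ-mono-≤ {n = n} z≤n = 0≤fromℕ n
  fromℕ-mono-≤ (s≤s m≤n) = +-monoʳ-≤ 1# (fromℕ-mono-≤ m≤n)

  0<1 : 0# < 1#
  0<1 = 0≤1 , 0≢1

  <-≤-trans : ∀ {x y z} → x < y → y ≤ z → x < z
  <-≤-trans (x≤y , x≢y) y≤z =
    ≤-trans x≤y y≤z , λ x≡z → x≢y (≤-antisym x≤y (subst (_ ≤_) (sym x≡z) y≤z))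

  <⇒≱ : ∀ {x y} → x < y → ¬ (y ≤ x)
  <⇒≱ (x≤y , x≢y) y≤x = x≢y (≤-antisym x≤y y≤x)

  0<fromℕ : ∀ n .{{_ : NonZero n}} → 0# < fromℕ n
  0<fromℕ (suc n) = <-≤-trans 0<1 (≤-by (fromℕ n) (0≤fromℕ n) refl)

  x≤x+y : ∀ x {y} → 0# ≤ y → x ≤ x + y
  x≤x+y x {y} 0≤y = ≤-by y 0≤y refl

  ÷-* : ∀ x {y} → 0# < y → (x ÷ y) * y ≡ x
  ÷-* x {y} (_ , 0≢y) = begin
    x * y ⁻¹ * y    ≡⟨ solve 3 (λ x y z → x :* z :* y := x :* (y :* z)) refl x y (y ⁻¹) ⟩
    x * (y * y ⁻¹)  ≡⟨ cong (x *_) (⁻¹-inverseʳ y (0≢y ∘ sym)) ⟩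
    x * 1#          ≡⟨ *-identityʳ x ⟩
    x               ∎
    where open ≡-Reasoning

  *-cancel-0≤ : ∀ {x y} → 0# < y → 0# ≤ x * y → 0# ≤ x
  *-cancel-0≤ {x} {y} 0<y@(0≤y , 0≢y) 0≤xy with ≤-total 0# x
  ... | inj₁ 0≤x = 0≤x
  ... | inj₂ x≤0 = ≤-reflexive (sym x≡0)
    where
    xy≤0 : x * y ≤ 0#
    xy≤0 = ≤-by ((0# - x) * y) (*-nonNeg (x≤y⇒0≤y-x x≤0) 0≤y)
      (solve 2 (λ x y → x :* y :+ (nat 0 :- x) :* y := nat 0) refl x y)
    x≡0 : x ≡ 0#
    x≡0 = begin
      x                ≡⟨ *-identityʳ x ⟨
      x * 1#           ≡⟨ cong (x *_) (⁻¹-inverseʳ y (0≢y ∘ sym)) ⟨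
      x * (y * y ⁻¹)   ≡⟨ *-assoc x y _ ⟨
      x * y * y ⁻¹     ≡⟨ cong (_* y ⁻¹) (≤-antisym xy≤0 0≤xy) ⟩
      0# * y ⁻¹        ≡⟨ zeroˡ _ ⟩
      0#               ∎
      where open ≡-Reasoning

  *-cancelʳ-≤ : ∀ {x y z} → 0# < z → x * z ≤ y * z → x ≤ y
  *-cancelʳ-≤ {x} {y} {z} 0<z p = 0≤y-x⇒x≤y $ *-cancel-0≤ 0<z $ subst (0# ≤_)
    (solve 3 (λ x y z → y :* z :- x :* z := (y :- x) :* z) refl x y z) (x≤y⇒0≤y-x p)

  frac-* : ∀ a b .{{_ : NonZero b}} → frac a b * fromℕ b ≡ fromℕ a
  frac-* a b = ÷-* (fromℕ a) (0<fromℕ b)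

  sum-mono-≤ : ∀ {n} {f g : Fin n → ℝ} → (∀ i → f i ≤ g i) → sum f ≤ sum g
  sum-mono-≤ {zero}  f≤g = ≤-refl
  sum-mono-≤ {suc n} f≤g = +-mono-≤ (f≤g zero) (sum-mono-≤ (f≤g ∘ suc))

-- The maximum of `F` and its numerical value.

module Optimum (R : RealNumbers) where

  open Scheduling R
  open OrderedField R

  frac≤ : ∀ c d .{{_ : NonZero d}} {x} → fromℕ c ≤ x * fromℕ d → frac c d ≤ x
  frac≤ c d p = *-cancelʳ-≤ (0<fromℕ d) (≤-trans (≤-reflexive (frac-* c d)) p)

  ≤frac : ∀ c d .{{_ : NonZero d}} {x} → x * fromℕ d ≤ fromℕ c → x ≤ frac c d
  ≤frac c d p = *-cancelʳ-≤ (0<fromℕ d) (≤-trans p (≤-reflexive (sym (frac-* c d))))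

  *-monoˡ-≤ : ∀ {z x y} → 0# ≤ z → x ≤ y → x * z ≤ y * z
  *-monoˡ-≤ 0≤z x≤y = subst₂ _≤_ (*-comm _ _) (*-comm _ _) (*-monoʳ-≤ 0≤z x≤y)

  frac≤⁻ : ∀ c d .{{_ : NonZero d}} {x} → frac c d ≤ x → fromℕ c ≤ x * fromℕ d
  frac≤⁻ c d p = ≤-trans (≤-reflexive (sym (frac-* c d))) (*-monoˡ-≤ (0≤fromℕ d) p)

  ≤frac⁻ : ∀ c d .{{_ : NonZero d}} {x} → x ≤ frac c d → x * fromℕ d ≤ fromℕ c
  ≤frac⁻ c d p = ≤-trans (*-monoˡ-≤ (0≤fromℕ d) p) (≤-reflexive (frac-* c d))

  frac-mono : ∀ a b c d .{{_ : NonZero b}} .{{_ : NonZero d}} →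
              a ℕ.* d ℕ.≤ c ℕ.* b → frac a b ≤ frac c d
  frac-mono a b c d p = frac≤ a b $ *-cancelʳ-≤ (0<fromℕ d) $ begin
    fromℕ a * fromℕ d               ≡⟨ fromℕ-* a d ⟨
    fromℕ (a ℕ.* d)                 ≤⟨ fromℕ-mono-≤ p ⟩
    fromℕ (c ℕ.* b)                 ≡⟨ fromℕ-* c b ⟩
    fromℕ c * fromℕ b               ≡⟨ cong (_* fromℕ b) (frac-* c d) ⟨
    frac c d * fromℕ d * fromℕ b    ≡⟨ solve 3 (λ x y z → x :* y :* z := x :* z :* y) refl _ _ _ ⟩
    frac c d * fromℕ b * fromℕ d    ∎
    where open ≤-Reasoning

  -- A bound on the speed of increase replaces continuity. Let `s` be the supremum of the points
  -- where `f` is nonpositive. If `f s` were positive, `f` would be positive within `f s ÷ K` to the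
  -- left of `s`, so `s` would not be the least bound. If it were negative, `f` would still be
  -- nonpositive at `s + (- f s) ÷ K`; that point does not pass `b` because `f b` is nonnegative.
  intermediateValue : ∀ (f : ℝ → ℝ) {a b K} → 0# < K → a ≤ b →
    (∀ {x y} → a ≤ x → x ≤ y → y ≤ b → f y ≤ f x + K * (y - x)) →
    f a ≤ 0# → 0# ≤ f b → ∃[ x ] a ≤ x × x ≤ b × f x ≡ 0#
  intermediateValue f {a} {b} {K} 0<K a≤b lip fa≤0 0≤fb =
    s , a≤s , s≤b , ≤-antisym fs≤0 0≤fs
    where
    P : ℝ → Set
    P x = a ≤ x × x ≤ b × f x ≤ 0#
    sup-P = complete P (a , ≤-refl , a≤b , fa≤0) (b , λ _ → proj₁ ∘ proj₂)
    s = proj₁ sup-P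
    P≤s = proj₁ (proj₂ sup-P)
    s-least = proj₂ (proj₂ sup-P)
    a≤s = P≤s a (≤-refl , a≤b , fa≤0)
    s≤b = s-least b (λ _ → proj₁ ∘ proj₂)
    open ≤-Reasoning
    fs≤0 : f s ≤ 0#
    fs≤0 = begin
      f s      ≡⟨ ÷-* (f s) 0<K ⟨
      ε * K    ≤⟨ *-monoˡ-≤ (proj₁ 0<K) ε≤0 ⟩
      0# * K   ≡⟨ zeroˡ K ⟩
      0#       ∎
      where
      ε = f s ÷ K
      bound : ∀ x → P x → x ≤ s - ε
      bound x (a≤x , x≤b , fx≤0) = 0≤y-x⇒x≤y $ *-cancel-0≤ 0<K $ begin
        0#                                   ≤⟨ x≤y⇒0≤y-x (lip a≤x (P≤s x (a≤x , x≤b , fx≤0)) s≤b) ⟩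
        f x + K * (s - x) - f s              ≤⟨ +-mono-≤ (+-mono-≤ fx≤0 ≤-refl) ≤-refl ⟩
        0# + K * (s - x) - f s               ≡⟨ cong (λ z → 0# + K * (s - x) - z) (÷-* (f s) 0<K) ⟨
        0# + K * (s - x) - ε * K             ≡⟨ solve 4 (λ K s x e → nat 0 :+ K :* (s :- x) :- e :* K := (s :- e :- x) :* K) refl K s x ε ⟩
        (s - ε - x) * K                      ∎
      ε≤0 : ε ≤ 0#
      ε≤0 = +-cancelˡ-≤ (s - ε) $ begin
        s - ε + ε   ≡⟨ solve 2 (λ s e → s :- e :+ e := s) refl s ε ⟩
        s           ≤⟨ s-least (s - ε) bound ⟩
        s - ε       ≡⟨ +-identityʳ _ ⟨
        s - ε + 0#  ∎
    0≤fs : 0# ≤ f s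
    0≤fs = subst₂ _≤_ -0#≈0# (-‿involutive (f s)) $ neg-mono-≤ $ begin
      - f s    ≡⟨ ÷-* (- f s) 0<K ⟨
      ε * K    ≤⟨ *-monoˡ-≤ (proj₁ 0<K) ε≤0 ⟩
      0# * K   ≡⟨ zeroˡ K ⟩
      0#       ∎
      where
      ε = (- f s) ÷ K
      0≤ε : 0# ≤ ε
      0≤ε = *-cancel-0≤ 0<K $ subst₂ _≤_ -0#≈0# (sym (÷-* (- f s) 0<K)) (neg-mono-≤ fs≤0)
      s≤s+ε = x≤x+y s 0≤ε
      s+ε≤b : s + ε ≤ b
      s+ε≤b = 0≤y-x⇒x≤y $ *-cancel-0≤ 0<K $ begin
        0#                             ≤⟨ 0≤fb ⟩
        f b                            ≤⟨ lip a≤s s≤b ≤-refl ⟩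
        f s + K * (b - s)              ≡⟨ solve 4 (λ y K b s → y :+ K :* (b :- s) := K :* (b :- s) :- (:- y)) refl (f s) K b s ⟩
        K * (b - s) - (- f s)          ≡⟨ cong (λ z → K * (b - s) - z) (÷-* (- f s) 0<K) ⟨
        K * (b - s) - ε * K            ≡⟨ solve 4 (λ K b s e → K :* (b :- s) :- e :* K := (b :- (s :+ e)) :* K) refl K b s ε ⟩
        (b - (s + ε)) * K              ∎
      fs+ε≤0 : f (s + ε) ≤ 0#
      fs+ε≤0 = begin
        f (s + ε)                  ≤⟨ lip a≤s s≤s+ε s+ε≤b ⟩
        f s + K * (s + ε - s)      ≡⟨ solve 4 (λ y K s e → y :+ K :* (s :+ e :- s) := y :+ e :* K) refl (f s) K s ε ⟩
        f s + ε * K                ≡⟨ cong (f s +_) (÷-* (- f s) 0<K) ⟩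
        f s - f s                  ≡⟨ -‿inverseʳ (f s) ⟩
        0#                         ∎
      ε≤0 : ε ≤ 0#
      ε≤0 = +-cancelˡ-≤ s $ subst (s + ε ≤_) (sym (+-identityʳ s))
        (P≤s (s + ε) (≤-trans a≤s s≤s+ε , s+ε≤b , fs+ε≤0))

  cubic : ℝ → ℝ
  cubic x = x * x * x + x * x - fromℕ 3 * x - fromℕ 1

  -- The divided difference is `x² + x y + y² + x + y - 3`, at most `4 + 4 + 4 + 2 + 2 - 3 = 13` on
  -- `[0 , 2]`.
  cubic-lipschitz : ∀ {x y} → 0# ≤ x → x ≤ y → y ≤ fromℕ 2 →
                    cubic y ≤ cubic x + fromℕ 13 * (y - x)
  cubic-lipschitz {x} {y} 0≤x x≤y y≤2 = ≤-by
    ((y - x) * ((fromℕ 4 - y * y) + (fromℕ 4 - x * y) + (fromℕ 4 - x * x) + (fromℕ 2 - y) + (fromℕ 2 - x)))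
    (*-nonNeg (x≤y⇒0≤y-x x≤y)
      (+-nonNeg (+-nonNeg (+-nonNeg (+-nonNeg
        (x≤y⇒0≤y-x (≤4 y≤2 y≤2 0≤y)) (x≤y⇒0≤y-x (≤4 x≤2 y≤2 0≤x)))
        (x≤y⇒0≤y-x (≤4 x≤2 x≤2 0≤x))) (x≤y⇒0≤y-x y≤2)) (x≤y⇒0≤y-x x≤2)))
    (solve 2 (λ x y →
      (y :* y :* y :+ y :* y :- nat 3 :* y :- nat 1) :+
      (y :- x) :* ((nat 4 :- y :* y) :+ (nat 4 :- x :* y) :+ (nat 4 :- x :* x) :+ (nat 2 :- y) :+ (nat 2 :- x))
      := x :* x :* x :+ x :* x :- nat 3 :* x :- nat 1 :+ nat 13 :* (y :- x)) refl x y)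
    where
    x≤2 = ≤-trans x≤y y≤2
    0≤y = ≤-trans 0≤x x≤y
    ≤4 : ∀ {u v} → u ≤ fromℕ 2 → v ≤ fromℕ 2 → 0# ≤ u → u * v ≤ fromℕ 4
    ≤4 {u} {v} u≤2 v≤2 0≤u = ≤-trans (*-mono-≤ 0≤u (0≤fromℕ 2) u≤2 v≤2)
      (≤-reflexive (sym (fromℕ-* 2 2)))

  -- Multiplying by `b³` and keeping positive and negative terms apart reduces the sign of the cubic
  -- at a rational to a comparison of natural numbers, settled by evaluation.
  cubic-frac : ∀ a b .{{_ : NonZero b}} →
    cubic (frac a b) * (fromℕ b * fromℕ b * fromℕ b) ≡
    fromℕ (a ℕ.* a ℕ.* a ℕ.+ a ℕ.* a ℕ.* b) - fromℕ (3 ℕ.* (a ℕ.* b ℕ.* b) ℕ.+ b ℕ.* b ℕ.* b)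
  cubic-frac a b = begin
    cubic q * (B * B * B)
      ≡⟨ solve 2 (λ q B → (q :* q :* q :+ q :* q :- nat 3 :* q :- nat 1) :* (B :* B :* B) :=
           (q :* B) :* (q :* B) :* (q :* B) :+ (q :* B) :* (q :* B) :* B
           :- (nat 3 :* ((q :* B) :* B :* B) :+ B :* B :* B)) refl q B ⟩
    (q * B) * (q * B) * (q * B) + (q * B) * (q * B) * B - (fromℕ 3 * ((q * B) * B * B) + B * B * B)
      ≡⟨ cong (λ A → A * A * A + A * A * B - (fromℕ 3 * (A * B * B) + B * B * B)) (frac-* a b) ⟩
    A * A * A + A * A * B - (fromℕ 3 * (A * B * B) + B * B * B)
      ≡⟨ cong₂ _-_
           (trans (fromℕ-+ (a ℕ.* a ℕ.* a) (a ℕ.* a ℕ.* b)) (cong₂ _+_ (cubed a a a) (cubed a a b)))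
           (trans (fromℕ-+ (3 ℕ.* (a ℕ.* b ℕ.* b)) (b ℕ.* b ℕ.* b))
             (cong₂ _+_ (trans (fromℕ-* 3 (a ℕ.* b ℕ.* b)) (cong (fromℕ 3 *_) (cubed a b b))) (cubed b b b))) ⟨
    fromℕ (a ℕ.* a ℕ.* a ℕ.+ a ℕ.* a ℕ.* b) - fromℕ (3 ℕ.* (a ℕ.* b ℕ.* b) ℕ.+ b ℕ.* b ℕ.* b) ∎
    where
    open ≡-Reasoning
    q = frac a b
    A = fromℕ a
    B = fromℕ b
    cubed : ∀ x y z → fromℕ (x ℕ.* y ℕ.* z) ≡ fromℕ x * fromℕ y * fromℕ z
    cubed x y z = trans (fromℕ-* (x ℕ.* y) z) (cong (_* fromℕ z) (fromℕ-* x y))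

  0<cube : ∀ b .{{_ : NonZero b}} → 0# < fromℕ b * fromℕ b * fromℕ b
  0<cube (suc b) = subst (0# <_)
    (trans (fromℕ-* (suc b ℕ.* suc b) (suc b)) (cong (_* fromℕ (suc b)) (fromℕ-* (suc b) (suc b))))
    (0<fromℕ (suc b ℕ.* suc b ℕ.* suc b))

  cubic-frac≤0 : ∀ a b .{{_ : NonZero b}} →
    a ℕ.* a ℕ.* a ℕ.+ a ℕ.* a ℕ.* b ℕ.≤ 3 ℕ.* (a ℕ.* b ℕ.* b) ℕ.+ b ℕ.* b ℕ.* b →
    cubic (frac a b) ≤ 0#
  cubic-frac≤0 a b p = *-cancelʳ-≤ (0<cube b) $ subst₂ _≤_ (sym (cubic-frac a b))
    (trans (-‿inverseʳ _) (sym (zeroˡ _))) (+-mono-≤ (fromℕ-mono-≤ p) ≤-refl)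

  0≤cubic-frac : ∀ a b .{{_ : NonZero b}} →
    3 ℕ.* (a ℕ.* b ℕ.* b) ℕ.+ b ℕ.* b ℕ.* b ℕ.≤ a ℕ.* a ℕ.* a ℕ.+ a ℕ.* a ℕ.* b →
    0# ≤ cubic (frac a b)
  0≤cubic-frac a b p = *-cancel-0≤ (0<cube b) $
    subst (0# ≤_) (sym (cubic-frac a b)) (x≤y⇒0≤y-x (fromℕ-mono-≤ p))

  -- The bracket is tight enough to fix the maximiser to four decimals, and `hi` stays below 40/27.
  lo hi : ℝ
  lo = frac 148115 100000
  hi = frac 148120 100000

  cubicRoot : ∃[ ρ ] lo ≤ ρ × ρ ≤ hi × cubic ρ ≡ 0#
  cubicRoot = intermediateValue cubic (0<fromℕ 13)
    (frac-mono 148115 100000 148120 100000 (ℕ.≤ᵇ⇒≤ _ _ _))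
    (λ {x} {y} lo≤x x≤y y≤hi → cubic-lipschitz {x} {y} (≤-trans 0≤lo lo≤x) x≤y (≤-trans y≤hi hi≤2))
    (cubic-frac≤0 148115 100000 (ℕ.≤ᵇ⇒≤ _ _ _))
    (0≤cubic-frac 148120 100000 (ℕ.≤ᵇ⇒≤ _ _ _))
    where
    0≤lo : 0# ≤ lo
    0≤lo = *-cancel-0≤ (0<fromℕ 100000) (≤-trans (0≤fromℕ 148115) (≤-reflexive (sym (frac-* 148115 100000))))
    hi≤2 : hi ≤ fromℕ 2
    hi≤2 = *-cancelʳ-≤ (0<fromℕ 100000) $ ≤-trans (≤-reflexive (frac-* 148120 100000)) $
      ≤-trans (fromℕ-mono-≤ {148120} {2 ℕ.* 100000} (ℕ.≤ᵇ⇒≤ _ _ _)) (≤-reflexive (fromℕ-* 2 100000))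

  frac≤recip : ∀ c d .{{_ : NonZero d}} {x y} → 0# < y → x * y ≡ fromℕ 1 →
               fromℕ c * y ≤ fromℕ d → frac c d ≤ x
  frac≤recip c d {x} {y} 0<y xy≡1 p = frac≤ c d $ *-cancelʳ-≤ 0<y $ begin
    fromℕ c * y        ≤⟨ p ⟩
    fromℕ d            ≡⟨ solve 1 (λ d → d := d :* nat 1) refl (fromℕ d) ⟩
    fromℕ d * fromℕ 1  ≡⟨ cong (fromℕ d *_) xy≡1 ⟨
    fromℕ d * (x * y)  ≡⟨ solve 3 (λ d x y → d :* (x :* y) := x :* d :* y) refl (fromℕ d) x y ⟩
    x * fromℕ d * y    ∎
    where open ≤-Reasoning

  recip≤frac : ∀ c d .{{_ : NonZero d}} {x y} → 0# < y → x * y ≡ fromℕ 1 →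
               fromℕ d ≤ fromℕ c * y → x ≤ frac c d
  recip≤frac c d {x} {y} 0<y xy≡1 p = ≤frac c d $ *-cancelʳ-≤ 0<y $ begin
    x * fromℕ d * y    ≡⟨ solve 3 (λ d x y → d :* (x :* y) := x :* d :* y) refl (fromℕ d) x y ⟨
    fromℕ d * (x * y)  ≡⟨ cong (fromℕ d *_) xy≡1 ⟩
    fromℕ d * fromℕ 1  ≡⟨ solve 1 (λ d → d := d :* nat 1) refl (fromℕ d) ⟨
    fromℕ d            ≤⟨ p ⟩
    fromℕ c * y        ∎
    where open ≤-Reasoning

  module _ (b : ℕ) .{{_ : NonZero b}} {ρ : ℝ} where

    private
      B = fromℕ b
      0≤B = 0≤fromℕ b

      scale₁ : ∀ c → fromℕ c * (ρ + fromℕ 2) * B ≡ fromℕ c * (ρ * B + fromℕ 2 * B)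
      scale₁ c = solve 3 (λ c ρ B → c :* (ρ :+ nat 2) :* B := c :* (ρ :* B :+ nat 2 :* B)) refl (fromℕ c) ρ B

      scale₂ : ∀ c → fromℕ c * (ρ * (ρ + fromℕ 2)) * (B * B) ≡
                     fromℕ c * ((ρ * B) * (ρ * B + fromℕ 2 * B))
      scale₂ c = solve 3 (λ c ρ B → c :* (ρ :* (ρ :+ nat 2)) :* (B :* B) :=
        c :* ((ρ :* B) :* (ρ :* B :+ nat 2 :* B))) refl (fromℕ c) ρ B

      eval₁ : ∀ u → fromℕ (u ℕ.+ 2 ℕ.* b) ≡ fromℕ u + fromℕ 2 * B
      eval₁ u = trans (fromℕ-+ u (2 ℕ.* b)) (cong (fromℕ u +_) (fromℕ-* 2 b))

      eval₂ : ∀ u → fromℕ (u ℕ.* (u ℕ.+ 2 ℕ.* b)) ≡ fromℕ u * (fromℕ u + fromℕ 2 * B)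
      eval₂ u = trans (fromℕ-* u (u ℕ.+ 2 ℕ.* b)) (cong (fromℕ u *_) (eval₁ u))

      0<BB : 0# < B * B
      0<BB = positive b
        where
        positive : ∀ n .{{_ : NonZero n}} → 0# < fromℕ n * fromℕ n
        positive (suc n) = subst (0# <_) (fromℕ-* (suc n) (suc n)) (0<fromℕ (suc n ℕ.* suc n))

    open ≤-Reasoning

    -- Here `u / b` is a rational bound on `ρ`. Clearing the denominator turns a bound on `ρ + 2`
    -- into the numeral inequality `p`; the quadratic versions do the same for `ρ (ρ + 2)` with
    -- `b²`.
    linear≤ : ∀ c d u → ρ * B ≤ fromℕ u →
              c ℕ.* (u ℕ.+ 2 ℕ.* b) ℕ.≤ d ℕ.* b →
              fromℕ c * (ρ + fromℕ 2) ≤ fromℕ d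
    linear≤ c d u ρB≤u p = *-cancelʳ-≤ (0<fromℕ b) $ begin
      fromℕ c * (ρ + fromℕ 2) * B           ≡⟨ scale₁ c ⟩
      fromℕ c * (ρ * B + fromℕ 2 * B)       ≤⟨ *-monoʳ-≤ (0≤fromℕ c) (+-mono-≤ ρB≤u ≤-refl) ⟩
      fromℕ c * (fromℕ u + fromℕ 2 * B)     ≡⟨ cong (fromℕ c *_) (eval₁ u) ⟨
      fromℕ c * fromℕ (u ℕ.+ 2 ℕ.* b)       ≡⟨ fromℕ-* c (u ℕ.+ 2 ℕ.* b) ⟨
      fromℕ (c ℕ.* (u ℕ.+ 2 ℕ.* b))         ≤⟨ fromℕ-mono-≤ p ⟩
      fromℕ (d ℕ.* b)                       ≡⟨ fromℕ-* d b ⟩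
      fromℕ d * B                           ∎

    ≤linear : ∀ c d u → fromℕ u ≤ ρ * B →
              d ℕ.* b ℕ.≤ c ℕ.* (u ℕ.+ 2 ℕ.* b) →
              fromℕ d ≤ fromℕ c * (ρ + fromℕ 2)
    ≤linear c d u u≤ρB p = *-cancelʳ-≤ (0<fromℕ b) $ begin
      fromℕ d * B                           ≡⟨ fromℕ-* d b ⟨
      fromℕ (d ℕ.* b)                       ≤⟨ fromℕ-mono-≤ p ⟩
      fromℕ (c ℕ.* (u ℕ.+ 2 ℕ.* b))         ≡⟨ fromℕ-* c (u ℕ.+ 2 ℕ.* b) ⟩
      fromℕ c * fromℕ (u ℕ.+ 2 ℕ.* b)       ≡⟨ cong (fromℕ c *_) (eval₁ u) ⟩
      fromℕ c * (fromℕ u + fromℕ 2 * B)     ≤⟨ *-monoʳ-≤ (0≤fromℕ c) (+-mono-≤ u≤ρB ≤-refl) ⟩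
      fromℕ c * (ρ * B + fromℕ 2 * B)       ≡⟨ scale₁ c ⟨
      fromℕ c * (ρ + fromℕ 2) * B           ∎

    quadratic≤ : ∀ c d u → 0# ≤ ρ → ρ * B ≤ fromℕ u →
                 c ℕ.* (u ℕ.* (u ℕ.+ 2 ℕ.* b)) ℕ.≤ d ℕ.* (b ℕ.* b) →
                 fromℕ c * (ρ * (ρ + fromℕ 2)) ≤ fromℕ d
    quadratic≤ c d u 0≤ρ ρB≤u p = *-cancelʳ-≤ 0<BB $ begin
      fromℕ c * (ρ * (ρ + fromℕ 2)) * (B * B)           ≡⟨ scale₂ c ⟩
      fromℕ c * ((ρ * B) * (ρ * B + fromℕ 2 * B))       ≤⟨ *-monoʳ-≤ (0≤fromℕ c) (*-mono-≤
          (*-nonNeg 0≤ρ 0≤B) (+-nonNeg (0≤fromℕ u) (*-nonNeg (0≤fromℕ 2) 0≤B)) ρB≤u (+-mono-≤ ρB≤u ≤-refl)) ⟩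
      fromℕ c * (fromℕ u * (fromℕ u + fromℕ 2 * B))     ≡⟨ cong (fromℕ c *_) (eval₂ u) ⟨
      fromℕ c * fromℕ (u ℕ.* (u ℕ.+ 2 ℕ.* b))           ≡⟨ fromℕ-* c _ ⟨
      fromℕ (c ℕ.* (u ℕ.* (u ℕ.+ 2 ℕ.* b)))             ≤⟨ fromℕ-mono-≤ p ⟩
      fromℕ (d ℕ.* (b ℕ.* b))                           ≡⟨ trans (fromℕ-* d (b ℕ.* b)) (cong (fromℕ d *_) (fromℕ-* b b)) ⟩
      fromℕ d * (B * B)                                 ∎

    ≤quadratic : ∀ c d u → 0# ≤ ρ → fromℕ u ≤ ρ * B →
                 d ℕ.* (b ℕ.* b) ℕ.≤ c ℕ.* (u ℕ.* (u ℕ.+ 2 ℕ.* b)) →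
                 fromℕ d ≤ fromℕ c * (ρ * (ρ + fromℕ 2))
    ≤quadratic c d u 0≤ρ u≤ρB p = *-cancelʳ-≤ 0<BB $ begin
      fromℕ d * (B * B)                                 ≡⟨ trans (fromℕ-* d (b ℕ.* b)) (cong (fromℕ d *_) (fromℕ-* b b)) ⟨
      fromℕ (d ℕ.* (b ℕ.* b))                           ≤⟨ fromℕ-mono-≤ p ⟩
      fromℕ (c ℕ.* (u ℕ.* (u ℕ.+ 2 ℕ.* b)))             ≡⟨ fromℕ-* c _ ⟩
      fromℕ c * fromℕ (u ℕ.* (u ℕ.+ 2 ℕ.* b))           ≡⟨ cong (fromℕ c *_) (eval₂ u) ⟩
      fromℕ c * (fromℕ u * (fromℕ u + fromℕ 2 * B))     ≤⟨ *-monoʳ-≤ (0≤fromℕ c) (*-mono-≤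
          (0≤fromℕ u) (+-nonNeg (*-nonNeg 0≤ρ 0≤B) (*-nonNeg (0≤fromℕ 2) 0≤B)) u≤ρB (+-mono-≤ u≤ρB ≤-refl)) ⟩
      fromℕ c * ((ρ * B) * (ρ * B + fromℕ 2 * B))       ≡⟨ scale₂ c ⟨
      fromℕ c * (ρ * (ρ + fromℕ 2)) * (B * B)           ∎

  module _ {ρ} (lo≤ρ : lo ≤ ρ) (ρ≤hi : ρ ≤ hi) (root : cubic ρ ≡ 0#) where

    private
      -- The gradient of `ρ den - num` vanishes where `2 ρ α + ρ β = 1` and `ρ α + (ρ + 1) β = 1`.
      -- Subtracting gives `β = ρ α`, and then `α D = 1`.
      D α β : ℝ
      D = ρ * (ρ + fromℕ 2)
      α = fromℕ 1 ÷ D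
      β = ρ * α

      ρ-lower : fromℕ 148115 ≤ ρ * fromℕ 100000
      ρ-lower = frac≤⁻ 148115 100000 lo≤ρ
      ρ-upper : ρ * fromℕ 100000 ≤ fromℕ 148120
      ρ-upper = ≤frac⁻ 148120 100000 ρ≤hi

      1≤ρ : fromℕ 1 ≤ ρ
      1≤ρ = *-cancelʳ-≤ (0<fromℕ 100000) (≤-trans (≤-reflexive (sym (fromℕ-* 1 100000)))
        (≤-trans (fromℕ-mono-≤ {1 ℕ.* 100000} {148115} (ℕ.≤ᵇ⇒≤ _ _ _)) ρ-lower))

      0<ρ : 0# < ρ
      0<ρ = <-≤-trans (0<fromℕ 1) 1≤ρ

      0≤ρ = proj₁ 0<ρ

      1≤D : fromℕ 1 ≤ D
      1≤D = ≤-trans 1≤ρ $ ≤-by (ρ * (ρ + fromℕ 1))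
        (*-nonNeg 0≤ρ (+-nonNeg 0≤ρ (0≤fromℕ 1)))
        (solve 1 (λ ρ → ρ :+ ρ :* (ρ :+ nat 1) := ρ :* (ρ :+ nat 2)) refl ρ)

      0<D = <-≤-trans (0<fromℕ 1) 1≤D

      αD≡1 : α * D ≡ fromℕ 1
      αD≡1 = ÷-* (fromℕ 1) 0<D

      0≤α : 0# ≤ α
      0≤α = *-cancel-0≤ 0<D (subst (0# ≤_) (sym αD≡1) (0≤fromℕ 1))

      β[ρ+2]≡1 : β * (ρ + fromℕ 2) ≡ fromℕ 1
      β[ρ+2]≡1 = trans (solve 2 (λ ρ α → ρ :* α :* (ρ :+ nat 2) := α :* (ρ :* (ρ :+ nat 2))) refl ρ α) αD≡1

      0<ρ+2 : 0# < ρ + fromℕ 2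
      0<ρ+2 = <-≤-trans 0<ρ (x≤x+y ρ (0≤fromℕ 2))

    -- Both `α` and `β` decrease in `ρ`, so the lower bounds come from `ρ-upper` and the upper
    -- bounds from `ρ-lower`.
    α-lower : frac 19385 100000 ≤ α
    α-lower = frac≤recip 19385 100000 0<D αD≡1
      (quadratic≤ 100000 19385 100000 148120 0≤ρ ρ-upper (ℕ.≤ᵇ⇒≤ _ _ _))

    α-upper : α ≤ frac 19395 100000
    α-upper = recip≤frac 19395 100000 0<D αD≡1
      (≤quadratic 100000 19395 100000 148115 0≤ρ ρ-lower (ℕ.≤ᵇ⇒≤ _ _ _))

    β-lower : frac 28725 100000 ≤ β
    β-lower = frac≤recip 28725 100000 0<ρ+2 β[ρ+2]≡1
      (linear≤ 100000 28725 100000 148120 ρ-upper (ℕ.≤ᵇ⇒≤ _ _ _))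

    β-upper : β ≤ frac 28735 100000
    β-upper = recip≤frac 28735 100000 0<ρ+2 β[ρ+2]≡1
      (≤linear 100000 28735 100000 148115 ρ-lower (ℕ.≤ᵇ⇒≤ _ _ _))

    region : Region α β
    region = 0≤α , ≤-by ((ρ - fromℕ 1) * α) (*-nonNeg (x≤y⇒0≤y-x 1≤ρ) 0≤α)
        (solve 2 (λ ρ α → α :+ (ρ :- nat 1) :* α := ρ :* α) refl ρ α)
      -- Since `α D = 1`, the claim times `D` reads `ρ + 1 ≤ D`, and
      -- `D - (ρ + 1) = (ρ - 1) (ρ + 2) + 1`.
      , *-cancelʳ-≤ 0<D (≤-by ((ρ - fromℕ 1) * (ρ + fromℕ 2) + fromℕ 1)
          (+-nonNeg (*-nonNeg (x≤y⇒0≤y-x 1≤ρ) (proj₁ 0<ρ+2)) (0≤fromℕ 1)) (begin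
            (α + β) * D + ((ρ - fromℕ 1) * (ρ + fromℕ 2) + fromℕ 1)
              ≡⟨ solve 2 (λ ρ α → (α :+ ρ :* α) :* (ρ :* (ρ :+ nat 2)) :+ ((ρ :- nat 1) :* (ρ :+ nat 2) :+ nat 1) :=
                   (α :* (ρ :* (ρ :+ nat 2))) :* (ρ :+ nat 1) :+ ((ρ :- nat 1) :* (ρ :+ nat 2) :+ nat 1)) refl ρ α ⟩
            α * D * (ρ + fromℕ 1) + ((ρ - fromℕ 1) * (ρ + fromℕ 2) + fromℕ 1)
              ≡⟨ cong (λ z → z * (ρ + fromℕ 1) + ((ρ - fromℕ 1) * (ρ + fromℕ 2) + fromℕ 1)) αD≡1 ⟩
            fromℕ 1 * (ρ + fromℕ 1) + ((ρ - fromℕ 1) * (ρ + fromℕ 2) + fromℕ 1)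
              ≡⟨ solve 1 (λ ρ → nat 1 :* (ρ :+ nat 1) :+ ((ρ :- nat 1) :* (ρ :+ nat 2) :+ nat 1) := ρ :* (ρ :+ nat 2)) refl ρ ⟩
            D       ≡⟨ *-identityˡ D ⟨
            1# * D  ∎))
      where open ≡-Reasoning

    private
      -- This is `α + β = ρ - 1`, and it is where the cubic enters: the value of `ρ den - num` at
      -- its critical point is `½ (ρ - 1 - α - β)`, which has to vanish.
      α[ρ+1]≡ρ-1 : α * (ρ + fromℕ 1) ≡ ρ - fromℕ 1
      α[ρ+1]≡ρ-1 = begin
        α * (ρ + fromℕ 1)
          ≡⟨ solve 2 (λ ρ α → α :* (ρ :+ nat 1) :=
               (ρ :- nat 1) :* (α :* (ρ :* (ρ :+ nat 2))) :- α :* (ρ :* ρ :* ρ :+ ρ :* ρ :- nat 3 :* ρ :- nat 1)) refl ρ α ⟩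
        (ρ - fromℕ 1) * (α * D) - α * cubic ρ
          ≡⟨ cong₂ (λ u v → (ρ - fromℕ 1) * u - α * v) αD≡1 root ⟩
        (ρ - fromℕ 1) * fromℕ 1 - α * 0#
          ≡⟨ solve 2 (λ ρ α → (ρ :- nat 1) :* nat 1 :- α :* nat 0 := ρ :- nat 1) refl ρ α ⟩
        ρ - fromℕ 1 ∎
        where open ≡-Reasoning

      num den gap : ℝ → ℝ → ℝ
      num x y = ½ + x + y - ½ * (y * y)
      den x y = ½ + x * x + x * y + ½ * (y * y)
      gap x y = ρ * ((x - α) * (x - α)) + ρ * ((x - α + (y - β)) * (x - α + (y - β))) + (y - β) * (y - β)

      ½*2≡1 : ½ * fromℕ 2 ≡ fromℕ 1
      ½*2≡1 = frac-* 1 2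

      0≤½ : 0# ≤ ½
      0≤½ = *-cancel-0≤ (0<fromℕ 2) (subst (0# ≤_) (sym ½*2≡1) (0≤fromℕ 1))

      -- To the solver `½` and `α` are opaque, so `collect` isolates the products whose values come
      -- from outside: `½ * 2`, `α * D` and `α * (ρ + 1)`.
      num+gap : ∀ x y → num x y + ½ * gap x y ≡ ρ * den x y
      num+gap x y = begin
        num x y + ½ * gap x y
          ≡⟨ solve 5 (λ h x y ρ α →
               h :+ x :+ y :- h :* (y :* y) :+ h :* (ρ :* ((x :- α) :* (x :- α))
                 :+ ρ :* ((x :- α :+ (y :- ρ :* α)) :* (x :- α :+ (y :- ρ :* α))) :+ (y :- ρ :* α) :* (y :- ρ :* α))
               := h :+ x :+ y :+ h :* (ρ :* (y :* y)) :+ (h :* nat 2) :* (ρ :* (x :* x :+ x :* y))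
                 :- (h :* nat 2) :* ((α :* (ρ :* (ρ :+ nat 2))) :* (x :+ y))
                 :+ h :* ((α :* (ρ :* (ρ :+ nat 2))) :* (α :* (ρ :+ nat 1)))) refl ½ x y ρ α ⟩
        collect (½ * fromℕ 2) (α * D) (α * (ρ + fromℕ 1))
          ≡⟨ cong₂ (λ u v → collect u v (α * (ρ + fromℕ 1))) ½*2≡1 αD≡1 ⟩
        collect (fromℕ 1) (fromℕ 1) (α * (ρ + fromℕ 1))
          ≡⟨ cong (collect (fromℕ 1) (fromℕ 1)) α[ρ+1]≡ρ-1 ⟩
        collect (fromℕ 1) (fromℕ 1) (ρ - fromℕ 1)
          ≡⟨ solve 4 (λ h x y ρ →
               h :+ x :+ y :+ h :* (ρ :* (y :* y)) :+ nat 1 :* (ρ :* (x :* x :+ x :* y))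
                 :- nat 1 :* (nat 1 :* (x :+ y)) :+ h :* (nat 1 :* (ρ :- nat 1))
               := ρ :* (h :+ x :* x :+ x :* y :+ h :* (y :* y))) refl ½ x y ρ ⟩
        ρ * den x y ∎
        where
        open ≡-Reasoning
        collect : ℝ → ℝ → ℝ → ℝ
        collect u v w = ½ + x + y + ½ * (ρ * (y * y)) + u * (ρ * (x * x + x * y))
          - u * (v * (x + y)) + ½ * (v * w)

      0<den : ∀ {x y} → Region x y → 0# < den x y
      0<den {x} {y} (0≤x , x≤y , _) = <-≤-trans 0<½ (≤-by (x * x + x * y + ½ * (y * y))
        (+-nonNeg (+-nonNeg (0≤x² x) (*-nonNeg 0≤x (≤-trans 0≤x x≤y))) (*-nonNeg 0≤½ (0≤x² y)))
        (solve 3 (λ h x y → h :+ (x :* x :+ x :* y :+ h :* (y :* y)) := h :+ x :* x :+ x :* y :+ h :* (y :* y)) refl ½ x y))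
        where
        0<½ : 0# < ½
        0<½ = 0≤½ , λ 0≡½ → proj₂ (0<fromℕ 1) (trans (sym (zeroˡ (fromℕ 2))) (trans (cong (_* fromℕ 2) 0≡½) ½*2≡1))

    F≤ρ : ∀ {x y} → Region x y → F x y ≤ ρ
    F≤ρ {x} {y} r = *-cancelʳ-≤ (0<den r) $ begin
      F x y * den x y   ≡⟨ ÷-* (num x y) (0<den r) ⟩
      num x y           ≤⟨ ≤-by (½ * gap x y) (*-nonNeg 0≤½ (+-nonNeg (+-nonNeg
                             (*-nonNeg 0≤ρ (0≤x² _)) (*-nonNeg 0≤ρ (0≤x² _))) (0≤x² _))) (num+gap x y) ⟩
      ρ * den x y       ∎
      where open ≤-Reasoning

    F-max≡ρ : F α β ≡ ρ
    F-max≡ρ = ≤-antisym (F≤ρ region) $ *-cancelʳ-≤ (0<den region) $ ≤-reflexive $ begin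
      ρ * den α β              ≡⟨ num+gap α β ⟨
      num α β + ½ * gap α β    ≡⟨ solve 5 (λ n h ρ α β →
           n :+ h :* (ρ :* ((α :- α) :* (α :- α)) :+ ρ :* ((α :- α :+ (β :- β)) :* (α :- α :+ (β :- β)))
             :+ (β :- β) :* (β :- β)) := n) refl (num α β) ½ ρ α β ⟩
      num α β                  ≡⟨ ÷-* (num α β) (0<den region) ⟨
      F α β * den α β          ∎
      where open ≡-Reasoning

  -- The last component is all that the lower bound uses about `ρ`: 40/27 is a fraction with small
  -- terms strictly between `hi` and 3/2.
  optimum : ∃[ ρ ] Isρ ρ
    × frac 14811 10000 ≤ ρ
    × (∃[ α ] ∃[ β ] Region α β × F α β ≡ ρ
    × frac 19385 100000 ≤ α × α ≤ frac 19395 100000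
    × frac 28725 100000 ≤ β × β ≤ frac 28735 100000)
    × ρ ≤ frac 40 27
  optimum = let ρ , l , h , z = cubicRoot in
      ρ , ((_ , _ , region l h z , sym (F-max≡ρ l h z)) , λ { _ (_ , _ , r , refl) → F≤ρ l h z r })
    , ≤-trans (frac-mono 14811 10000 148115 100000 (ℕ.≤ᵇ⇒≤ _ _ _)) l
    , (_ , _ , region l h z , F-max≡ρ l h z , α-lower l h z , α-upper l h z , β-lower l h z , β-upper l h z)
    , ≤-trans h (frac-mono 148120 100000 40 27 (ℕ.≤ᵇ⇒≤ _ _ _))

-- Suprema and infima in the extended reals.

module ExtendedSup (em : ExcludedMiddle 0ℓ) (R : RealNumbers) where

  open Scheduling R

  [_]≰⊥± : ∀ x → ¬ ([ x ] ≤± ⊥±)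
  [ x ]≰⊥± [ () ]⁺

  -- Completeness covers inhabited bounded sets of reals; excluded middle sends the remaining cases
  -- to `⊥±` or `⊤±`. Hence the asymptotic ratio of every algorithm exists as an extended real.
  supremum : (P : Pred (ℝ ±) 0ℓ) → ∃ (ℝ±-Bounds.IsSup P)
  supremum P with em {P ⊤±}
  ... | yes p = ⊤± , (λ x _ → _≤⊤± _≤_ x) , λ u ub → ub ⊤± p
  ... | no ¬p with em {∃[ x ] P [ x ]}
  ...   | no ¬q = ⊥± , ub , λ u _ → ⊥±≤_ _≤_ u
    where
    ub : ℝ±-Bounds.UpperBound P ⊥±
    ub ⊥±    _ = ⊥±≤_ _≤_ ⊥±
    ub [ x ] q = contradiction (x , q) ¬q
    ub ⊤±    p = contradiction p ¬p
  ...   | yes (x , q) with em {∃ (ℝ-Bounds.UpperBound λ y → P [ y ])}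
  ...     | yes bounded = let s , ub , least = complete _ (x , q) bounded in
            [ s ]
          , (λ { ⊥± _ → ⊥±≤_ _≤_ [ s ] ; [ y ] r → [ ub y r ] ; ⊤± p → contradiction p ¬p })
          , λ { ⊥± ub′ → contradiction (ub′ [ x ] q) [ x ]≰⊥±
              ; [ u ] ub′ → [ least u (λ y r → [≤]-injective _≤_ (ub′ [ y ] r)) ]
              ; ⊤± _ → _≤⊤± _≤_ [ s ] }
  ...     | no unbounded = ⊤± , (λ y _ → _≤⊤± _≤_ y)
          , λ { ⊥± ub → contradiction (ub [ x ] q) [ x ]≰⊥±
              ; [ u ] ub → contradiction (u , λ y r → [≤]-injective _≤_ (ub [ y ] r)) unbounded
              ; ⊤± _ → _≤⊤± _≤_ ⊤± }

  -- The supremum of the lower bounds.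
  infimum : (P : Pred (ℝ ±) 0ℓ) → ∃ (ℝ±-Bounds.IsInf P)
  infimum P = let i , ub , least = supremum (ℝ±-Bounds.LowerBound P) in
    i , (λ x p → least x (λ l lb → lb x p)) , λ l lb → ub l lb

-- Sorting a finite family of reals.

module SortedFamilies (R : RealNumbers) where

  open Scheduling R
  open OrderedField R

  argmin : ∀ {n} (f : Fin (suc n) → ℝ) → ∃[ i ] ∀ j → f i ≤ f j
  argmin {zero}  f = zero , λ { zero → ≤-refl }
  argmin {suc n} f with argmin (f ∘ suc)
  ... | i , min with ≤-total (f zero) (f (suc i))
  ...   | inj₁ f₀≤fᵢ = zero , λ { zero → ≤-refl ; (suc j) → ≤-trans f₀≤fᵢ (min j) }
  ...   | inj₂ fᵢ≤f₀ = suc i , λ { zero → fᵢ≤f₀ ; (suc j) → min j }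

  -- Selection sort: a transposition brings a minimal entry to the front and the tail is sorted
  -- recursively. It serves to order operations by start and jobs by completion of their tests.
  sortingPermutation : ∀ {n} (f : Fin n → ℝ) →
    Σ (Permutation′ n) λ σ → ∀ {i j} → i Fin.≤ j → f (σ ⟨$⟩ʳ i) ≤ f (σ ⟨$⟩ʳ j)
  sortingPermutation {zero}  f = Permutation.id , λ { {()} }
  sortingPermutation {suc n} f with argmin f
  ... | i₀ , min with sortingPermutation (f ∘ (transpose zero i₀ ⟨$⟩ʳ_) ∘ suc)
  ...   | σ , sorted = lift₀ σ ∘ₚ transpose zero i₀ , mono
    where
    mono : ∀ {i j : Fin (suc n)} → i Fin.≤ j →
           f (lift₀ σ ∘ₚ transpose zero i₀ ⟨$⟩ʳ i) ≤ f (lift₀ σ ∘ₚ transpose zero i₀ ⟨$⟩ʳ j)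
    mono {zero}  {j}     _         = min _
    mono {suc i} {suc j} (s≤s i≤j) = sorted i≤j

-- The quadratic load inequality for disjoint intervals on `m` machines.

module MachineLoad (em : ExcludedMiddle 0ℓ) (R : RealNumbers) where

  open Scheduling R
  open OrderedField R
  open SortedFamilies R

  -- Equal to `(s + w - a)² - (s - a)²`, twice the integral of `x - a` over the interval from `s` to
  -- `s + w`. Disjoint intervals to the right of `a` minimise the total when packed from `a` on,
  -- where it is the square of their total length.
  moment : ℝ → ℝ → ℝ → ℝ
  moment a s w = w * (fromℕ 2 * (s - a) + w)

  sum-*ʳ : ∀ {n} c (f : Fin n → ℝ) → sum (λ i → c * f i) ≡ c * sum f
  sum-*ʳ c f = sym (*-distribˡ-sum c f)

  sum-const : ∀ n {x} → sum {n} (λ _ → x) ≡ fromℕ n * x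
  sum-const zero    {x} = sym (zeroˡ x)
  sum-const (suc n) {x} = trans (cong (x +_) (sum-const n)) $ begin
    x + fromℕ n * x        ≡⟨ cong (_+ fromℕ n * x) (*-identityˡ x) ⟨
    1# * x + fromℕ n * x   ≡⟨ solve 3 (λ x n o → o :* x :+ n :* x := (o :+ n) :* x) refl x (fromℕ n) 1# ⟩
    (1# + fromℕ n) * x     ∎
    where open ≡-Reasoning

  sum-nonNeg : ∀ {n} {f : Fin n → ℝ} → (∀ i → 0# ≤ f i) → 0# ≤ sum f
  sum-nonNeg {n} {f} 0≤f = subst (_≤ sum f) (trans (sum-const n) (zeroʳ _)) (sum-mono-≤ 0≤f)

  -- Lets the induction below restart its origin at the end of the first interval.
  sum-moment : ∀ {n} (s w : Fin n → ℝ) a a′ →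
    sum (λ i → moment a (s i) (w i)) ≡
    sum (λ i → moment a′ (s i) (w i)) + fromℕ 2 * (a′ - a) * sum w
  sum-moment s w a a′ = begin
    sum (λ i → moment a (s i) (w i))
      ≡⟨ sum-cong-≗ (λ i → solve 4 (λ a a′ s w → w :* (nat 2 :* (s :- a) :+ w) :=
           w :* (nat 2 :* (s :- a′) :+ w) :+ nat 2 :* (a′ :- a) :* w) refl a a′ (s i) (w i)) ⟩
    sum (λ i → moment a′ (s i) (w i) + fromℕ 2 * (a′ - a) * w i)
      ≡⟨ ∑-distrib-+ (λ i → moment a′ (s i) (w i)) (λ i → fromℕ 2 * (a′ - a) * w i) ⟩
    sum (λ i → moment a′ (s i) (w i)) + sum (λ i → fromℕ 2 * (a′ - a) * w i)
      ≡⟨ cong (_ +_) (sum-*ʳ (fromℕ 2 * (a′ - a)) w) ⟩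
    sum (λ i → moment a′ (s i) (w i)) + fromℕ 2 * (a′ - a) * sum w ∎
    where open ≡-Reasoning

  -- Induction along the intervals in order of time. Entries of length zero are exempt from the
  -- order because the lemma is applied to families in which the operations of all other machines
  -- are masked by zero.
  sum²≤sum-moment : ∀ {n} (s w : Fin n → ℝ) a → (∀ i → 0# ≤ w i) →
    (∀ i → w i ≢ 0# → a ≤ s i) →
    (∀ {i j} → i Fin.< j → w i ≢ 0# → w j ≢ 0# → s i + w i ≤ s j) →
    sum w * sum w ≤ sum (λ i → moment a (s i) (w i))
  sum²≤sum-moment {zero}  s w a 0≤w a≤s packed = ≤-reflexive (zeroˡ 0#)
  sum²≤sum-moment {suc n} s w a 0≤w a≤s packed with em {w zero ≡ 0#}
  ... | yes w₀≡0 = begin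
    (w zero + W) * (w zero + W)     ≡⟨ cong (λ z → (z + W) * (z + W)) w₀≡0 ⟩
    (0# + W) * (0# + W)             ≡⟨ cong (λ z → z * z) (+-identityˡ W) ⟩
    W * W                           ≤⟨ sum²≤sum-moment (s ∘ suc) (w ∘ suc) a (0≤w ∘ suc) (a≤s ∘ suc)
                                         (λ i<j → packed (s≤s i<j)) ⟩
    M                               ≡⟨ solve 2 (λ M z → M := nat 0 :* z :+ M) refl M _ ⟩
    0# * (fromℕ 2 * (s zero - a) + 0#) + M  ≡⟨ cong (λ z → moment a (s zero) z + M) w₀≡0 ⟨
    moment a (s zero) (w zero) + M  ∎
    where
    open ≤-Reasoning
    W = sum (w ∘ suc)
    M = sum (λ i → moment a (s (suc i)) (w (suc i)))
  ... | no w₀≢0 = begin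
    (w zero + W) * (w zero + W)
      -- Besides the slack of the induction hypothesis, the difference is the delay `s zero - a`
      -- before the first interval, which shifts the whole load.
      ≤⟨ ≤-by ((M′ - W * W) + fromℕ 2 * ((s zero - a) * (w zero + W)))
           (+-nonNeg (x≤y⇒0≤y-x W²≤M′) (*-nonNeg (0≤fromℕ 2)
             (*-nonNeg (x≤y⇒0≤y-x (a≤s zero w₀≢0)) (+-nonNeg (0≤w zero) 0≤W))))
           (solve 5 (λ w W s a M′ → (w :+ W) :* (w :+ W) :+ ((M′ :- W :* W) :+ nat 2 :* ((s :- a) :* (w :+ W)))
             := w :* (nat 2 :* (s :- a) :+ w) :+ (M′ :+ nat 2 :* (s :+ w :- a) :* W)) refl (w zero) W (s zero) a M′) ⟩
    moment a (s zero) (w zero) + (M′ + fromℕ 2 * (a′ - a) * W)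
      ≡⟨ cong (moment a (s zero) (w zero) +_) (sum-moment (s ∘ suc) (w ∘ suc) a a′) ⟨
    moment a (s zero) (w zero) + sum (λ i → moment a (s (suc i)) (w (suc i))) ∎
    where
    open ≤-Reasoning
    a′ = s zero + w zero
    W = sum (w ∘ suc)
    M′ = sum (λ i → moment a′ (s (suc i)) (w (suc i)))
    W²≤M′ : W * W ≤ M′
    W²≤M′ = sum²≤sum-moment (s ∘ suc) (w ∘ suc) a′ (0≤w ∘ suc)
      (λ i → packed (s≤s z≤n) w₀≢0) (λ i<j → packed (s≤s i<j))
    0≤W : 0# ≤ W
    0≤W = sum-nonNeg (0≤w ∘ suc)

  -- Masking instead of filtering keeps one index set for all machines, so that a sum over machines
  -- can be exchanged with the sum over operations.
  only : ∀ {m} → Fin m → Fin m → ℝ → ℝ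
  only q r x = if does (q Fin.≟ r) then x else 0#

  sum-only : ∀ {m} (r : Fin m) x → sum (λ q → only q r x) ≡ x
  sum-only {suc m} zero x = trans (cong (x +_) (trans (sum-const m) (zeroʳ _))) (+-identityʳ x)
  sum-only (suc r) x = trans (+-identityˡ _) (sum-only r x)

  sum-sum-only : ∀ {m n} (μ : Fin n → Fin m) (f : Fin n → ℝ) →
                 sum (λ q → sum (λ i → only q (μ i) (f i))) ≡ sum f
  sum-sum-only μ f = trans (∑-comm (λ q i → only q (μ i) (f i)))
    (sum-cong-≗ (λ i → sum-only (μ i) (f i)))

  moment-only : ∀ {m} (q r : Fin m) a s w → moment a s (only q r w) ≡ only q r (moment a s w)
  moment-only q r a s w with does (q Fin.≟ r)
  ... | true  = refl
  ... | false = zeroˡ _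

  only-nonNeg : ∀ {m} (q r : Fin m) {x} → 0# ≤ x → 0# ≤ only q r x
  only-nonNeg q r 0≤x with does (q Fin.≟ r)
  ... | true  = 0≤x
  ... | false = ≤-refl

  only-≢0 : ∀ {m} (q r : Fin m) {x} → only q r x ≢ 0# → q ≡ r × only q r x ≡ x × x ≢ 0#
  only-≢0 q r ≢0 with q Fin.≟ r
  ... | yes q≡r = q≡r , refl , ≢0
  ... | no _    = contradiction refl ≢0

  -- On each machine the squared load P² bounds the sum of the moments; the
  -- tangent 2 c P - c² to it makes the bound linear, with c to be chosen as the
  -- average load.
  load-bound-sorted : ∀ {m n} (s w : Fin n → ℝ) (μ : Fin n → Fin m) a →
    (∀ i → 0# ≤ w i) → (∀ i → a ≤ s i) →
    (∀ {i j} → i ≢ j → μ i ≡ μ j → s i + w i ≤ s j ⊎ s j + w j ≤ s i) →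
    (∀ {i j} → i Fin.≤ j → s i ≤ s j) →
    ∀ c → fromℕ 2 * c * sum w - fromℕ m * (c * c) ≤ sum (λ i → moment a (s i) (w i))
  load-bound-sorted {m} {n} s w μ a 0≤w a≤s disjoint sorted c = begin
    fromℕ 2 * c * sum w - fromℕ m * (c * c)
      ≡⟨ cong₂ (λ u v → fromℕ 2 * c * u - v) (sum-sum-only μ w) (sum-const m) ⟨
    fromℕ 2 * c * sum W - sum {m} (λ _ → c * c)
      ≡⟨ solve 3 (λ W c k → nat 2 :* c :* W :- k := (nat 2 :* c) :* W :+ (:- nat 1) :* k) refl (sum W) c _ ⟩
    fromℕ 2 * c * sum W + - fromℕ 1 * sum {m} (λ _ → c * c)
      ≡⟨ cong₂ _+_ (sum-*ʳ (fromℕ 2 * c) W) (sum-*ʳ (- fromℕ 1) (λ (_ : Fin m) → c * c)) ⟨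
    sum (λ q → fromℕ 2 * c * W q) + sum {m} (λ _ → - fromℕ 1 * (c * c))
      ≡⟨ ∑-distrib-+ (λ q → fromℕ 2 * c * W q) (λ _ → - fromℕ 1 * (c * c)) ⟨
    sum (λ q → fromℕ 2 * c * W q + - fromℕ 1 * (c * c))
      ≤⟨ sum-mono-≤ (λ q → ≤-by ((W q - c) * (W q - c)) (0≤x² _)
           (solve 2 (λ W c → nat 2 :* c :* W :+ (:- nat 1) :* (c :* c) :+ (W :- c) :* (W :- c) := W :* W) refl (W q) c)) ⟩
    sum (λ q → W q * W q)
      ≤⟨ sum-mono-≤ machine-bound ⟩
    sum (λ q → sum (λ i → only q (μ i) (moment a (s i) (w i))))
      ≡⟨ sum-sum-only μ (λ i → moment a (s i) (w i)) ⟩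
    sum (λ i → moment a (s i) (w i)) ∎
    where
    open ≤-Reasoning
    wᵠ : Fin m → Fin n → ℝ
    wᵠ q i = only q (μ i) (w i)
    W : Fin m → ℝ
    W q = sum (wᵠ q)
    packed : ∀ q {i j} → i Fin.< j → wᵠ q i ≢ 0# → wᵠ q j ≢ 0# → s i + wᵠ q i ≤ s j
    packed q {i} {j} i<j i≢0 j≢0 with only-≢0 q (μ i) i≢0 | only-≢0 q (μ j) j≢0
    ... | q≡μᵢ , wᵢ≡ , _ | q≡μⱼ , _ , wⱼ≢0
        with disjoint (Fin.<⇒≢ i<j) (trans (sym q≡μᵢ) q≡μⱼ)
    ...   | inj₁ fᵢ≤sⱼ = subst (λ z → s i + z ≤ s j) (sym wᵢ≡) fᵢ≤sⱼ
    -- With the starts sorted, `s j + w j ≤ s i ≤ s j` would force `w j` to be zero.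
    ...   | inj₂ fⱼ≤sᵢ = contradiction
              (≤-antisym (+-cancelˡ-≤ (s j) (≤-trans fⱼ≤sᵢ (≤-trans (sorted (ℕ.<⇒≤ i<j))
                (≤-reflexive (sym (+-identityʳ (s j))))))) (0≤w j)) wⱼ≢0
    machine-bound : ∀ q → W q * W q ≤ sum (λ i → only q (μ i) (moment a (s i) (w i)))
    machine-bound q = ≤-trans
      (sum²≤sum-moment s (wᵠ q) a (λ i → only-nonNeg q (μ i) (0≤w i)) (λ i _ → a≤s i) (packed q))
      (≤-reflexive (sum-cong-≗ (λ i → moment-only q (μ i) a (s i) (w i))))

  permutation-injective : ∀ {n} (σ : Permutation′ n) {i j} → σ ⟨$⟩ʳ i ≡ σ ⟨$⟩ʳ j → i ≡ j
  permutation-injective σ = Injection.injective (↔⇒↣ σ)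

  -- Both sides are invariant under permuting the operations, so they may be sorted by start.
  load-bound : ∀ {m n} (s w : Fin n → ℝ) (μ : Fin n → Fin m) a →
    (∀ i → 0# ≤ w i) → (∀ i → a ≤ s i) →
    (∀ {i j} → i ≢ j → μ i ≡ μ j → s i + w i ≤ s j ⊎ s j + w j ≤ s i) →
    ∀ c → fromℕ 2 * c * sum w - fromℕ m * (c * c) ≤ sum (λ i → moment a (s i) (w i))
  load-bound {m} s w μ a 0≤w a≤s disjoint c with sortingPermutation s
  ... | σ , sorted = begin
    fromℕ 2 * c * sum w - fromℕ m * (c * c)
      ≡⟨ cong (λ z → fromℕ 2 * c * z - fromℕ m * (c * c)) (sum-permute w σ) ⟩
    fromℕ 2 * c * sum (w ∘ (σ ⟨$⟩ʳ_)) - fromℕ m * (c * c)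
      ≤⟨ load-bound-sorted (s ∘ (σ ⟨$⟩ʳ_)) (w ∘ (σ ⟨$⟩ʳ_)) (μ ∘ (σ ⟨$⟩ʳ_)) a (λ _ → 0≤w _) (λ _ → a≤s _)
           (λ i≢j → disjoint (i≢j ∘ permutation-injective σ)) sorted c ⟩
    sum (λ i → moment a (s (σ ⟨$⟩ʳ i)) (w (σ ⟨$⟩ʳ i)))
      ≡⟨ sum-permute (λ i → moment a (s i) (w i)) σ ⟨
    sum (λ i → moment a (s i) (w i)) ∎
    where open ≤-Reasoning

-- The adversary's instance and lower bounds on the cost of its schedules.

module HardInstances (em : ExcludedMiddle 0ℓ) (R : RealNumbers) where

  open Scheduling R
  open OrderedField R
  open SortedFamilies R
  open MachineLoad em R

  sum-++ : ∀ m {n} (f : Fin (m ℕ.+ n) → ℝ) →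
           sum f ≡ sum (λ i → f (i ↑ˡ n)) + sum (λ i → f (m ↑ʳ i))
  sum-++ zero    f = sym (+-identityˡ _)
  sum-++ (suc m) f = trans (cong (f zero +_) (sum-++ m (f ∘ suc))) (sym (+-assoc _ _ _))

  sum-affine : ∀ {n} c (f : Fin n → ℝ) d →
               sum (λ i → c * f i + d) ≡ c * sum f + fromℕ n * d
  sum-affine {n} c f d = trans (∑-distrib-+ (λ i → c * f i) (λ _ → d))
    (cong₂ _+_ (sum-*ʳ c f) (sum-const n))

  unitTests : ∀ {N} → (Fin N → ℕ) → Instance N
  unitTests q = record
    { t   = λ _ → fromℕ 1
    ; p   = λ j → fromℕ (q j)
    ; 0≤t = λ _ → 0≤fromℕ 1
    ; 0≤p = λ j → 0≤fromℕ (q j)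
    }

  0≤duration : ∀ {N} (I : Instance N) o → 0# ≤ duration I o
  0≤duration I (τ j) = 0≤t I j
  0≤duration I (π j) = 0≤p I j

  module Split n (σ : Permutation′ (n ℕ.+ n)) where

    -- Later `σ` lists the jobs by completion of their tests. It is arbitrary here, so that the same
    -- instance and notation also serve the offline schedule.
    long short : Fin n → Fin (n ℕ.+ n)
    long  i = σ ⟨$⟩ʳ (i ↑ˡ n)
    short i = σ ⟨$⟩ʳ (n ↑ʳ i)

    class : Fin (n ℕ.+ n) → Fin n ⊎ Fin n
    class j = splitAt n (σ ⟨$⟩ˡ j)

    class-long : ∀ i → class (long i) ≡ inj₁ i
    class-long i = trans (cong (splitAt n) (inverseˡ σ)) (Fin.splitAt-↑ˡ n i n)

    class-short : ∀ i → class (short i) ≡ inj₂ i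
    class-short i = trans (cong (splitAt n) (inverseˡ σ)) (Fin.splitAt-↑ʳ n n i)

    class-injective : ∀ {j j′} → class j ≡ class j′ → j ≡ j′
    class-injective {j} {j′} eq = trans (sym (inverseʳ σ)) (trans (cong (σ ⟨$⟩ʳ_)
      (trans (sym (Fin.join-splitAt n n _)) (trans (cong (Fin.join n n) eq) (Fin.join-splitAt n n _))))
      (inverseʳ σ))

    long-injective : ∀ {i i′} → long i ≡ long i′ → i ≡ i′
    long-injective eq = Fin.↑ˡ-injective n _ _ (permutation-injective σ eq)

    short-injective : ∀ {i i′} → short i ≡ short i′ → i ≡ i′
    short-injective eq = Fin.↑ʳ-injective n _ _ (permutation-injective σ eq)

    long-or-short : ∀ j → (∃[ i ] j ≡ long i) ⊎ (∃[ i ] j ≡ short i)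
    long-or-short j with class j in eq
    ... | inj₁ i = inj₁ (i , class-injective (trans eq (sym (class-long i))))
    ... | inj₂ i = inj₂ (i , class-injective (trans eq (sym (class-short i))))

    sum-split : ∀ f → sum f ≡ sum (f ∘ long) + sum (f ∘ short)
    sum-split f = trans (sum-permute f σ) (sum-++ n (f ∘ (σ ⟨$⟩ʳ_)))

    processing : Fin (n ℕ.+ n) → ℕ
    processing j = [ (λ _ → 2) , (λ _ → 0) ]′ (class j)

    processing-long : ∀ i → processing (long i) ≡ 2
    processing-long i = cong [ (λ _ → 2) , (λ _ → 0) ]′ (class-long i)

    processing-short : ∀ i → processing (short i) ≡ 0
    processing-short i = cong [ (λ _ → 2) , (λ _ → 0) ]′ (class-short i)

    hard : Instance (n ℕ.+ n)
    hard = unitTests processing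

    -- Apart from feasibility, the only property of the online schedule that enters its cost bound.
    Separates : ∀ {m} → ℝ → Schedule m (n ℕ.+ n) → Set
    Separates T S = (∀ i → start S (τ (long i)) + fromℕ 1 ≤ T)
                  × (∀ i → T ≤ start S (τ (short i)) + fromℕ 1)

  threshold : ∀ n (f : Fin (n ℕ.+ n) → ℝ) (σ : Permutation′ (n ℕ.+ n)) →
    (∀ {i j} → i Fin.≤ j → f (σ ⟨$⟩ʳ i) ≤ f (σ ⟨$⟩ʳ j)) →
    ∃[ T ] (∀ i → f (Split.long n σ i) ≤ T) × (∀ i → T ≤ f (Split.short n σ i))
  -- Without jobs any value separates; otherwise the cut is the completion of the test at position
  -- `n`, the earliest among the short jobs.
  threshold zero f σ sorted = 0# , (λ ()) , λ ()
  threshold (suc n) f σ sorted = f (Split.short (suc n) σ zero)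
    , (λ i → sorted (subst₂ ℕ._≤_ (sym (Fin.toℕ-↑ˡ i (suc n))) (sym (Fin.toℕ-↑ʳ (suc n) zero))
        (ℕ.≤-trans (ℕ.<⇒≤ (Fin.toℕ<n i)) (ℕ.m≤m+n (suc n) 0))))
    , (λ i → sorted (subst₂ ℕ._≤_ (sym (Fin.toℕ-↑ʳ (suc n) zero)) (sym (Fin.toℕ-↑ʳ (suc n) i))
        (ℕ.+-monoʳ-≤ (suc n) z≤n)))

  x+1≰x : ∀ x → ¬ (x + fromℕ 1 ≤ x)
  x+1≰x x p = <⇒≱ (0<fromℕ 1) (+-cancelˡ-≤ x (≤-trans p (≤-reflexive (sym (+-identityʳ x)))))

  -- Let all jobs be long and keep only the n jobs tested first long: the
  -- algorithm cannot notice the difference before the remaining tests complete.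
  separatingInstance : ∀ {m} (A : OnlineAlgorithm m) n →
    Σ (Permutation′ (n ℕ.+ n)) λ σ → let open Split n σ in
    ∃[ T ] Separates T (run A hard)
  separatingInstance A n = σ , T , long≤T , T≤short
    where
    allLong : Instance (n ℕ.+ n)
    allLong = unitTests (λ _ → 2)
    S₂ = run A allLong
    tested : Fin (n ℕ.+ n) → ℝ
    tested j = finish allLong S₂ (τ j)
    sorting = sortingPermutation tested
    σ = proj₁ sorting
    open Split n σ
    S = run A hard
    cut = threshold n tested σ (proj₂ sorting)
    T = proj₁ cut

    differs⇒short : ∀ j → fromℕ 2 ≢ fromℕ (processing j) → ∃[ i ] j ≡ short i
    differs⇒short j differs with long-or-short j
    ... | inj₁ (i , refl) = contradiction (cong fromℕ (sym (processing-long i))) differs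
    ... | inj₂ found      = found

    long≤T : ∀ i → start S (τ (long i)) + fromℕ 1 ≤ T
    long≤T i with em {SameAt S₂ S (τ (long i))}
    ... | yes (same , _) = subst (λ s → s + fromℕ 1 ≤ T) same (proj₁ (proj₂ cut) i)
    -- A deviation needs a completed test of a short job, the only jobs on which the instances
    -- differ. In the all-long run that happens no earlier than `T`, whereas this long test has
    -- ended by then.
    ... | no differs with nonAnticipating A allLong hard (λ _ → refl) (τ (long i)) differs
    ...   | j , p≢p′ , _ , fⱼ≤s with differs⇒short j p≢p′
    ...     | i′ , refl = contradiction
              (≤-trans (proj₁ (proj₂ cut) i) (≤-trans (proj₂ (proj₂ cut) i′) fⱼ≤s)) (x+1≰x _)

    T≤short : ∀ i → T ≤ start S (τ (short i)) + fromℕ 1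
    T≤short i with em {SameAt S S₂ (τ (short i))}
    ... | yes (same , _) = subst (λ s → T ≤ s + fromℕ 1) (sym same) (proj₂ (proj₂ cut) i)
    -- Here the revealing short test runs identically in both runs, so it ends no earlier than `T`
    -- and the deviating test starts after it.
    ... | no differs with nonAnticipating A hard allLong (λ _ → refl) (τ (short i)) differs
    ...   | j , p≢p′ , (same , _) , fⱼ≤s with differs⇒short j (p≢p′ ∘ sym)
    ...     | i′ , refl = begin
              T                                ≤⟨ proj₂ (proj₂ cut) i′ ⟩
              start S₂ (τ (short i′)) + fromℕ 1 ≡⟨ cong (_+ fromℕ 1) same ⟨
              start S (τ (short i′)) + fromℕ 1  ≤⟨ fⱼ≤s ⟩
              start S (τ (short i))            ≤⟨ x≤x+y _ (0≤fromℕ 1) ⟩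
              start S (τ (short i)) + fromℕ 1  ∎
      where open ≤-Reasoning

  τ-injective : ∀ {N} {j j′ : Fin N} → τ j ≡ τ j′ → j ≡ j′
  τ-injective refl = refl

  operation : ∀ {N} → Fin (N ℕ.+ N) → Operation N
  operation {N} i = [ τ , π ]′ (splitAt N i)

  operation-injective : ∀ {N} {i j : Fin (N ℕ.+ N)} → operation i ≡ operation j → i ≡ j
  operation-injective {N} {i} {j} eq = trans (sym (Fin.join-splitAt N N i))
    (trans (cong (Fin.join N N) (cases (splitAt N i) (splitAt N j) eq)) (Fin.join-splitAt N N j))
    where
    cases : (x y : Fin N ⊎ Fin N) → [ τ , π ]′ x ≡ [ τ , π ]′ y → x ≡ y
    cases (inj₁ _) (inj₁ _) refl = refl
    cases (inj₂ _) (inj₂ _) refl = refl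

  sum-operation : ∀ {N} (f : Operation N → ℝ) →
                  sum (λ i → f (operation i)) ≡ sum (f ∘ τ) + sum (f ∘ π)
  sum-operation {N} f = trans (sum-++ N (f ∘ operation)) (cong₂ _+_
    (sum-cong-≗ (λ j → cong (f ∘ [ τ , π ]′) (Fin.splitAt-↑ˡ N j N)))
    (sum-cong-≗ (λ j → cong (f ∘ [ τ , π ]′) (Fin.splitAt-↑ʳ N N j))))

  module _ {m k} (σ : Permutation′ (k ℕ.* m ℕ.+ k ℕ.* m)) (S : Schedule m (k ℕ.* m ℕ.+ k ℕ.* m)) where

    open Split (k ℕ.* m) σ

    private
      -- Choosing `n` as a multiple of `m` makes the average loads whole numbers: `k` for the tests
      -- of one class and `4 k` for all operations.
      n : ℕ
      n = k ℕ.* m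
      M K n̂ X Z P : ℝ
      M = fromℕ m
      K = fromℕ k
      n̂ = fromℕ n
      X = sum (λ i → start S (τ (long i)))
      Z = sum (λ i → start S (τ (short i)))
      P = sum (λ i → start S (π (long i)))

    module _ (feas : Feasible hard S) where

      open Feasible feas

      private
        total-duration : sum (λ i → duration hard (operation i)) ≡ fromℕ 4 * n̂
        total-duration = begin
          sum (λ i → duration hard (operation i))
            ≡⟨ sum-operation (duration hard) ⟩
          sum {n ℕ.+ n} (λ _ → fromℕ 1) + sum (λ j → fromℕ (processing j))
            ≡⟨ cong₂ _+_ (trans (sum-const (n ℕ.+ n)) (cong (_* fromℕ 1) (fromℕ-+ n n)))
                 (trans (sum-split (fromℕ ∘ processing)) (cong₂ _+_
                   (trans (sum-cong-≗ (cong fromℕ ∘ processing-long)) (sum-const n))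
                   (trans (sum-cong-≗ (cong fromℕ ∘ processing-short)) (sum-const n)))) ⟩
          (n̂ + n̂) * fromℕ 1 + (n̂ * fromℕ 2 + n̂ * fromℕ 0)
            ≡⟨ solve 1 (λ n → (n :+ n) :* nat 1 :+ (n :* nat 2 :+ n :* nat 0) := nat 4 :* n) refl n̂ ⟩
          fromℕ 4 * n̂ ∎
          where open ≡-Reasoning

        sum-moment-1 : (f : Fin n → Fin (n ℕ.+ n)) →
          sum (λ i → moment 0# (start S (τ (f i))) (fromℕ 1)) ≡
          fromℕ 2 * sum (λ i → start S (τ (f i))) + n̂ * fromℕ 1
        sum-moment-1 f = trans
          (sum-cong-≗ (λ i → solve 1 (λ s → nat 1 :* (nat 2 :* (s :- nat 0) :+ nat 1) := nat 2 :* s :+ nat 1) refl (start S (τ (f i)))))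
          (sum-affine (fromℕ 2) (λ i → start S (τ (f i))) (fromℕ 1))

        total-moment : sum (λ i → moment 0# (start S (operation i)) (duration hard (operation i))) ≡
                       fromℕ 2 * X + fromℕ 2 * Z + fromℕ 4 * P + fromℕ 6 * n̂
        total-moment = begin
          sum (λ i → moment 0# (start S (operation i)) (duration hard (operation i)))
            ≡⟨ sum-operation (λ o → moment 0# (start S o) (duration hard o)) ⟩
          sum (λ j → moment 0# (start S (τ j)) (fromℕ 1)) + sum (λ j → moment 0# (start S (π j)) (fromℕ (processing j)))
            ≡⟨ cong₂ _+_ (trans (sum-split (λ j → moment 0# (start S (τ j)) (fromℕ 1))) (cong₂ _+_ (sum-moment-1 long) (sum-moment-1 short)))
                 (trans (sum-split (λ j → moment 0# (start S (π j)) (fromℕ (processing j)))) (cong₂ _+_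
                   (trans (sum-cong-≗ (λ i → trans (cong (λ q → moment 0# (start S (π (long i))) (fromℕ q)) (processing-long i))
                     (solve 1 (λ s → nat 2 :* (nat 2 :* (s :- nat 0) :+ nat 2) := nat 4 :* s :+ nat 4) refl (start S (π (long i))))))
                     (sum-affine (fromℕ 4) (λ i → start S (π (long i))) (fromℕ 4)))
                   (trans (sum-cong-≗ (λ i → trans (cong (λ q → moment 0# (start S (π (short i))) (fromℕ q)) (processing-short i))
                     (zeroˡ _))) (sum-const n)))) ⟩
          fromℕ 2 * X + n̂ * fromℕ 1 + (fromℕ 2 * Z + n̂ * fromℕ 1) + (fromℕ 4 * P + n̂ * fromℕ 4 + n̂ * 0#)
            ≡⟨ solve 4 (λ X Z P n → nat 2 :* X :+ n :* nat 1 :+ (nat 2 :* Z :+ n :* nat 1) :+ (nat 4 :* P :+ n :* nat 4 :+ n :* nat 0)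
                 := nat 2 :* X :+ nat 2 :* Z :+ nat 4 :* P :+ nat 6 :* n) refl X Z P n̂ ⟩
          fromℕ 2 * X + fromℕ 2 * Z + fromℕ 4 * P + fromℕ 6 * n̂ ∎
          where open ≡-Reasoning

      -- The total length is `4 n`: the tests give `2 n` and the long processings another `2 n`.
      -- With tangent point `4 K` the left side equals `16 m k²`.
      all-operations : fromℕ 2 * (fromℕ 4 * K) * (fromℕ 4 * n̂) - M * (fromℕ 4 * K * (fromℕ 4 * K)) ≤
                       fromℕ 2 * X + fromℕ 2 * Z + fromℕ 4 * P + fromℕ 6 * n̂
      all-operations = subst₂ _≤_
        (cong (λ d → fromℕ 2 * (fromℕ 4 * K) * d - M * (fromℕ 4 * K * (fromℕ 4 * K))) total-duration) total-moment
        (load-bound (start S ∘ operation) (duration hard ∘ operation) (machine S ∘ operation) 0#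
          (λ i → 0≤duration hard (operation i)) (λ i → 0≤start (operation i))
          (λ i≢j → disjoint (i≢j ∘ operation-injective)) (fromℕ 4 * K))

      -- A unit test that ends no earlier than `T` starts no earlier than `T - 1`, the origin used
      -- for the moments. The left side equals `m k²`.
      short-tests : ∀ T → (∀ i → T ≤ start S (τ (short i)) + fromℕ 1) →
        fromℕ 2 * K * n̂ - M * (K * K) ≤ fromℕ 2 * Z + n̂ * (fromℕ 3 - fromℕ 2 * T)
      short-tests T T≤ = subst₂ _≤_
        (cong (λ d → fromℕ 2 * K * d - M * (K * K)) (trans (sum-const n) (solve 1 (λ n → n :* nat 1 := n) refl n̂)))
        (trans (sum-cong-≗ (λ i → solve 2 (λ s T → nat 1 :* (nat 2 :* (s :- (T :- nat 1)) :+ nat 1) :=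
            nat 2 :* s :+ (nat 3 :- nat 2 :* T)) refl (start S (τ (short i))) T))
          (sum-affine (fromℕ 2) (λ i → start S (τ (short i))) (fromℕ 3 - fromℕ 2 * T)))
        (load-bound (λ i → start S (τ (short i))) (λ _ → fromℕ 1) (λ i → machine S (τ (short i))) (T - fromℕ 1)
          (λ _ → 0≤fromℕ 1)
          (λ i → ≤-by (start S (τ (short i)) + fromℕ 1 - T) (x≤y⇒0≤y-x (T≤ i))
            (solve 2 (λ s T → T :- nat 1 :+ (s :+ nat 1 :- T) := s) refl (start S (τ (short i))) T))
          (λ i≢j → disjoint (i≢j ∘ short-injective ∘ τ-injective)) K)

      -- The bound for the time-reversed schedule.
      long-tests : ∀ T → (∀ i → start S (τ (long i)) + fromℕ 1 ≤ T) →
        fromℕ 2 * K * n̂ - M * (K * K) ≤ - fromℕ 2 * X + n̂ * (fromℕ 2 * T - fromℕ 1)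
      long-tests T ≤T = subst₂ _≤_
        (cong (λ d → fromℕ 2 * K * d - M * (K * K)) (trans (sum-const n) (solve 1 (λ n → n :* nat 1 := n) refl n̂)))
        (trans (sum-cong-≗ (λ i → solve 2 (λ s T → nat 1 :* (nat 2 :* ((:- (s :+ nat 1)) :- (:- T)) :+ nat 1) :=
            (:- nat 2) :* s :+ (nat 2 :* T :- nat 1)) refl (start S (τ (long i))) T))
          (sum-affine (- fromℕ 2) (λ i → start S (τ (long i))) (fromℕ 2 * T - fromℕ 1)))
        (load-bound (λ i → - (start S (τ (long i)) + fromℕ 1)) (λ _ → fromℕ 1) (λ i → machine S (τ (long i))) (- T)
          (λ _ → 0≤fromℕ 1) (λ i → neg-mono-≤ (≤T i))
          (λ i≢j μ≡ → Sum.map (reflect _ _) (reflect _ _)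
            (Sum.swap (disjoint (i≢j ∘ long-injective ∘ τ-injective) μ≡))) K)
        where
        reflect : ∀ s s′ → s′ + fromℕ 1 ≤ s → - (s + fromℕ 1) + fromℕ 1 ≤ - (s′ + fromℕ 1)
        reflect s s′ p = ≤-trans (≤-reflexive (solve 1 (λ s → (:- (s :+ nat 1)) :+ nat 1 := :- s) refl s)) (neg-mono-≤ p)

      -- A short job is charged only up to the end of its test; the `3 n` are the long processings
      -- and the short tests themselves.
      cost≥ : P + Z + fromℕ 3 * n̂ ≤ cost hard S
      cost≥ = begin
        P + Z + fromℕ 3 * n̂
          ≡⟨ solve 3 (λ P Z n → P :+ Z :+ nat 3 :* n := nat 1 :* P :+ n :* nat 2 :+ (nat 1 :* Z :+ n :* nat 1)) refl P Z n̂ ⟩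
        fromℕ 1 * P + n̂ * fromℕ 2 + (fromℕ 1 * Z + n̂ * fromℕ 1)
          ≡⟨ cong₂ _+_ (sum-affine (fromℕ 1) (λ i → start S (π (long i))) (fromℕ 2))
               (sum-affine (fromℕ 1) (λ i → start S (τ (short i))) (fromℕ 1)) ⟨
        sum (λ i → fromℕ 1 * start S (π (long i)) + fromℕ 2) + sum (λ i → fromℕ 1 * start S (τ (short i)) + fromℕ 1)
          ≤⟨ +-mono-≤
               (sum-mono-≤ λ i → ≤-reflexive (trans (cong (_+ fromℕ 2) (one* (start S (π (long i)))))
                 (cong (λ q → start S (π (long i)) + fromℕ q) (sym (processing-long i)))))
               (sum-mono-≤ λ i → ≤-trans (≤-reflexive (cong (_+ fromℕ 1) (one* (start S (τ (short i))))))
                 (≤-trans (test-first (short i)) (x≤x+y _ (0≤fromℕ (processing (short i)))))) ⟩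
        sum (λ i → finish hard S (π (long i))) + sum (λ i → finish hard S (π (short i)))
          ≡⟨ sum-split (λ j → finish hard S (π j)) ⟨
        cost hard S ∎
        where
        open ≤-Reasoning
        one* : ∀ x → fromℕ 1 * x ≡ x
        one* x = solve 1 (λ x → nat 1 :* x := x) refl x

      -- Bounds the costs from below uniformly in the schedule, so the infimum `OPT` exists and is
      -- positive.
      3n≤cost : fromℕ 3 * n̂ ≤ cost hard S
      3n≤cost = ≤-trans (≤-by (P + Z)
        (+-nonNeg (sum-nonNeg λ i → 0≤start (π (long i))) (sum-nonNeg λ i → 0≤start (τ (short i))))
        (+-comm _ _)) cost≥

      -- In the sum of the three inequalities the left sides give `16 + 1 + 1 = 18` times `m k²`. On
      -- the right `X` and `T` cancel, leaving `4 P + 4 Z + 8 n`, at most four times the bound in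
      -- `cost≥`.
      separated-cost : ∀ {T} → Separates T S → fromℕ 18 * (M * (K * K)) ≤ fromℕ 4 * cost hard S
      separated-cost {T} (long≤T , T≤short) = begin
        fromℕ 18 * (M * (K * K))
          ≡⟨ solve 2 (λ M K → nat 18 :* (M :* (K :* K)) :=
               (nat 2 :* (nat 4 :* K) :* (nat 4 :* (K :* M)) :- M :* (nat 4 :* K :* (nat 4 :* K)))
               :+ ((nat 2 :* K :* (K :* M) :- M :* (K :* K)) :+ (nat 2 :* K :* (K :* M) :- M :* (K :* K)))) refl M K ⟩
        bound (K * M)
          ≡⟨ cong bound (fromℕ-* k m) ⟨
        bound n̂
          ≤⟨ +-mono-≤ all-operations (+-mono-≤ (short-tests T T≤short) (long-tests T long≤T)) ⟩
        (fromℕ 2 * X + fromℕ 2 * Z + fromℕ 4 * P + fromℕ 6 * n̂)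
          + ((fromℕ 2 * Z + n̂ * (fromℕ 3 - fromℕ 2 * T)) + (- fromℕ 2 * X + n̂ * (fromℕ 2 * T - fromℕ 1)))
          ≤⟨ ≤-by (fromℕ 4 * n̂) (*-nonNeg (0≤fromℕ 4) (0≤fromℕ n))
               (solve 5 (λ X Z P n T → (nat 2 :* X :+ nat 2 :* Z :+ nat 4 :* P :+ nat 6 :* n)
                 :+ ((nat 2 :* Z :+ n :* (nat 3 :- nat 2 :* T)) :+ ((:- nat 2) :* X :+ n :* (nat 2 :* T :- nat 1)))
                 :+ nat 4 :* n := nat 4 :* (P :+ Z :+ nat 3 :* n)) refl X Z P n̂ T) ⟩
        fromℕ 4 * (P + Z + fromℕ 3 * n̂)
          ≤⟨ *-monoʳ-≤ (0≤fromℕ 4) cost≥ ⟩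
        fromℕ 4 * cost hard S ∎
        where
        open ≤-Reasoning
        bound : ℝ → ℝ
        bound x = (fromℕ 2 * (fromℕ 4 * K) * (fromℕ 4 * x) - M * (fromℕ 4 * K * (fromℕ 4 * K)))
          + ((fromℕ 2 * K * x - M * (K * K)) + (fromℕ 2 * K * x - M * (K * K)))

-- The offline schedule that runs the short jobs first.

module OfflineSchedule (em : ExcludedMiddle 0ℓ) (R : RealNumbers) where

  open Scheduling R
  open OrderedField R
  open MachineLoad em R
  open HardInstances em R

  sum-combine : ∀ k {m} (f : Fin (k ℕ.* m) → ℝ) →
                sum f ≡ sum (λ c → sum (λ q → f (combine {k} c q)))
  sum-combine zero    f = refl
  sum-combine (suc k) {m} f = trans (sum-++ m f) (cong (sum (λ q → f (q ↑ˡ (k ℕ.* m))) +_) (sum-combine k (f ∘ (m ↑ʳ_))))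

  gauss : ∀ k → fromℕ 2 * sum {k} (λ c → fromℕ (toℕ c)) ≡ fromℕ k * fromℕ k - fromℕ k
  gauss zero    = solve 0 (nat 2 :* nat 0 := nat 0 :* nat 0 :- nat 0) refl
  gauss (suc k) = begin
    fromℕ 2 * (0# + sum {k} (λ c → 1# + fromℕ (toℕ c)))
      ≡⟨ cong (λ z → fromℕ 2 * (0# + z)) shift ⟩
    fromℕ 2 * (0# + (K * 1# + G))
      ≡⟨ solve 3 (λ G K o → nat 2 :* (nat 0 :+ (K :* o :+ G)) := nat 2 :* G :+ nat 2 :* (K :* o)) refl G K 1# ⟩
    fromℕ 2 * G + fromℕ 2 * (K * 1#)
      ≡⟨ cong₂ (λ u v → u + fromℕ 2 * v) (gauss k) (*-identityʳ K) ⟩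
    K * K - K + fromℕ 2 * K
      ≡⟨ solve 1 (λ K → K :* K :- K :+ nat 2 :* K := (nat 1 :+ K) :* (nat 1 :+ K) :- (nat 1 :+ K)) refl K ⟩
    (fromℕ 1 + K) * (fromℕ 1 + K) - (fromℕ 1 + K)
      ≡⟨ cong (λ z → z * z - z) (fromℕ-+ 1 k) ⟨
    fromℕ (suc k) * fromℕ (suc k) - fromℕ (suc k) ∎
    where
    open ≡-Reasoning
    K = fromℕ k
    G = sum {k} (λ c → fromℕ (toℕ c))
    shift : sum {k} (λ c → 1# + fromℕ (toℕ c)) ≡ K * 1# + G
    shift = trans (∑-distrib-+ (λ (_ : Fin k) → 1#) (λ c → fromℕ (toℕ c))) (cong (_+ G) (sum-const k))

  sum-quotient : ∀ m k → fromℕ 2 * sum {k ℕ.* m} (λ i → fromℕ (toℕ (quotient {k} m i))) ≡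
                 fromℕ m * (fromℕ k * fromℕ k - fromℕ k)
  sum-quotient m k = begin
    fromℕ 2 * sum {k ℕ.* m} (λ i → fromℕ (toℕ (quotient {k} m i)))
      ≡⟨ cong (fromℕ 2 *_) (trans (sum-combine k (λ i → fromℕ (toℕ (quotient {k} m i))))
           (trans (sum-cong-≗ row) (sum-*ʳ (fromℕ m) (λ (c : Fin k) → fromℕ (toℕ c))))) ⟩
    fromℕ 2 * (fromℕ m * G)
      ≡⟨ solve 2 (λ M G → nat 2 :* (M :* G) := M :* (nat 2 :* G)) refl (fromℕ m) G ⟩
    fromℕ m * (fromℕ 2 * G)
      ≡⟨ cong (fromℕ m *_) (gauss k) ⟩
    fromℕ m * (fromℕ k * fromℕ k - fromℕ k) ∎
    where
    open ≡-Reasoning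
    G = sum {k} (λ c → fromℕ (toℕ c))
    row : ∀ (c : Fin k) → sum {m} (λ q → fromℕ (toℕ (quotient {k} m (combine {k} c q)))) ≡ fromℕ m * fromℕ (toℕ c)
    row c = begin
      sum {m} (λ q → fromℕ (toℕ (quotient {k} m (combine {k} c q))))
        ≡⟨ sum-cong-≗ {m} (λ q → cong (λ x → fromℕ (toℕ (proj₁ x))) (Fin.remQuot-combine c q)) ⟩
      sum {m} (λ _ → fromℕ (toℕ c))
        ≡⟨ sum-const m ⟩
      fromℕ m * fromℕ (toℕ c) ∎

  job : ∀ {N} → Operation N → Fin N
  job (τ j) = j
  job (π j) = j

  module _ {m k} (σ : Permutation′ (k ℕ.* m ℕ.+ k ℕ.* m)) where

    open Split (k ℕ.* m) σ

    private
      n : ℕ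
      n = k ℕ.* m

      -- Round robin: the quotient by `m` is the round and the remainder the machine, so every
      -- machine gets exactly `k` jobs of each class.
      slot : Fin n → ℕ
      slot i = toℕ (quotient {k} m i)

      -- A job occupies one block, its test included: on each machine the unit blocks of short jobs
      -- fill the time up to `k`, and the long blocks of length 3 follow without gaps.
      begins length ends : Fin n ⊎ Fin n → ℕ
      begins (inj₁ i) = 3 ℕ.* slot i ℕ.+ k
      begins (inj₂ i) = slot i
      length = [ (λ _ → 3) , (λ _ → 1) ]′
      ends c = length c ℕ.+ begins c

      machineOf : Fin n ⊎ Fin n → Fin m
      machineOf = [ remainder {k} m , remainder {k} m ]′

      slot<k : ∀ i → slot i ℕ.< k
      slot<k i = Fin.toℕ<n (quotient {k} m i)

      slot-injective : ∀ {i i′} → remainder {k} m i ≡ remainder {k} m i′ → slot i ≡ slot i′ → i ≡ i′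
      slot-injective {i} {i′} r≡ s≡ = trans (sym (Fin.combine-remQuot {k} m i))
        (trans (cong₂ combine (Fin.toℕ-injective s≡) r≡) (Fin.combine-remQuot {k} m i′))

      blocks-disjoint : ∀ c c′ → c ≢ c′ → machineOf c ≡ machineOf c′ →
                        ends c ℕ.≤ begins c′ ⊎ ends c′ ℕ.≤ begins c
      blocks-disjoint (inj₁ i) (inj₁ i′) c≢c′ μ≡ with ℕ.<-cmp (slot i) (slot i′)
      ... | tri< s<s′ _ _ = inj₁ (ℕ.+-monoˡ-≤ k (ℕ.≤-trans (ℕ.≤-reflexive (sym (ℕ.*-suc 3 (slot i)))) (ℕ.*-monoʳ-≤ 3 s<s′)))
      ... | tri≈ _ s≡s′ _ = contradiction (cong inj₁ (slot-injective μ≡ s≡s′)) c≢c′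
      ... | tri> _ _ s>s′ = inj₂ (ℕ.+-monoˡ-≤ k (ℕ.≤-trans (ℕ.≤-reflexive (sym (ℕ.*-suc 3 (slot i′)))) (ℕ.*-monoʳ-≤ 3 s>s′)))
      blocks-disjoint (inj₁ i) (inj₂ i′) _ _ = inj₂ (ℕ.≤-trans (slot<k i′) (ℕ.m≤n+m k (3 ℕ.* slot i)))
      blocks-disjoint (inj₂ i) (inj₁ i′) _ _ = inj₁ (ℕ.≤-trans (slot<k i) (ℕ.m≤n+m k (3 ℕ.* slot i′)))
      blocks-disjoint (inj₂ i) (inj₂ i′) c≢c′ μ≡ with ℕ.<-cmp (slot i) (slot i′)
      ... | tri< s<s′ _ _ = inj₁ s<s′
      ... | tri≈ _ s≡s′ _ = contradiction (cong inj₂ (slot-injective μ≡ s≡s′)) c≢c′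
      ... | tri> _ _ s>s′ = inj₂ s>s′

      startOf : Operation (n ℕ.+ n) → ℝ
      startOf (τ j) = fromℕ (begins (class j))
      startOf (π j) = fromℕ (begins (class j)) + fromℕ 1

    shortFirst : Schedule m (n ℕ.+ n)
    shortFirst = record
      { start   = startOf
      ; machine = λ o → machineOf (class (job o))
      }

    private
      length≡ : ∀ c → 1 ℕ.+ [ (λ _ → 2) , (λ _ → 0) ]′ c ≡ length c
      length≡ (inj₁ _) = refl
      length≡ (inj₂ _) = refl

      finish-π : ∀ j → finish hard shortFirst (π j) ≡ fromℕ (ends (class j))
      finish-π j = begin
        B + fromℕ 1 + fromℕ (processing j)     ≡⟨ solve 2 (λ B p → B :+ nat 1 :+ p := nat 1 :+ p :+ B) refl B _ ⟩
        fromℕ 1 + fromℕ (processing j) + B     ≡⟨ cong (_+ B) (fromℕ-+ 1 (processing j)) ⟨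
        fromℕ (1 ℕ.+ processing j) + B         ≡⟨ cong (λ l → fromℕ l + B) (length≡ (class j)) ⟩
        fromℕ (length (class j)) + B           ≡⟨ fromℕ-+ (length (class j)) (begins (class j)) ⟨
        fromℕ (ends (class j))                 ∎
        where
        open ≡-Reasoning
        B = fromℕ (begins (class j))

      begins≤start : ∀ o → fromℕ (begins (class (job o))) ≤ start shortFirst o
      begins≤start (τ j) = ≤-refl
      begins≤start (π j) = x≤x+y _ (0≤fromℕ 1)

      finish≤ends : ∀ o → finish hard shortFirst o ≤ fromℕ (ends (class (job o)))
      finish≤ends (τ j) = ≤-trans (x≤x+y _ (0≤fromℕ (processing j))) (≤-reflexive (finish-π j))
      finish≤ends (π j) = ≤-reflexive (finish-π j)

      same-job : ∀ o o′ → o ≢ o′ → job o ≡ job o′ →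
        finish hard shortFirst o ≤ start shortFirst o′ ⊎ finish hard shortFirst o′ ≤ start shortFirst o
      same-job (τ j) (τ j′) o≢o′ refl = contradiction refl o≢o′
      same-job (τ j) (π j′) o≢o′ refl = inj₁ ≤-refl
      same-job (π j) (τ j′) o≢o′ refl = inj₂ ≤-refl
      same-job (π j) (π j′) o≢o′ refl = contradiction refl o≢o′

      -- A processing follows its test immediately on the same machine, so two operations of one job
      -- abut and those of different jobs inherit the disjointness of their blocks.
      ops-disjoint : ∀ o o′ → o ≢ o′ → machine shortFirst o ≡ machine shortFirst o′ →
        finish hard shortFirst o ≤ start shortFirst o′ ⊎ finish hard shortFirst o′ ≤ start shortFirst o
      ops-disjoint o o′ o≢o′ μ≡ = case job o Fin.≟ job o′ of λ
        { (yes j≡j′) → same-job o o′ o≢o′ j≡j′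
        ; (no j≢j′)  → Sum.map (chain o o′) (chain o′ o)
            (blocks-disjoint (class (job o)) (class (job o′)) (j≢j′ ∘ class-injective) μ≡) }
        where
        chain : ∀ o o′ → ends (class (job o)) ℕ.≤ begins (class (job o′)) →
                finish hard shortFirst o ≤ start shortFirst o′
        chain o o′ p = ≤-trans (finish≤ends o) (≤-trans (fromℕ-mono-≤ p) (begins≤start o′))

    shortFirst-feasible : Feasible hard shortFirst
    shortFirst-feasible = record
      { 0≤start    = λ o → ≤-trans (0≤fromℕ (begins (class (job o)))) (begins≤start o)
      ; test-first = λ j → ≤-refl
      ; disjoint   = λ {o} {o′} → ops-disjoint o o′
      }

    -- The rounds enter with total weight `3 + 1`, contributing `2 m (k² - k)`. The offset `k` of
    -- the long jobs and the block lengths add `m k (k + 4)`.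
    shortFirst-cost : cost hard shortFirst ≡
      fromℕ 3 * (fromℕ m * (fromℕ k * fromℕ k)) + fromℕ 2 * (fromℕ m * fromℕ k)
    shortFirst-cost = begin
      sum (λ j → finish hard shortFirst (π j))
        ≡⟨ sum-cong-≗ finish-π ⟩
      sum (λ j → fromℕ (ends (class j)))
        ≡⟨ sum-split (λ j → fromℕ (ends (class j))) ⟩
      sum (λ i → fromℕ (ends (class (long i)))) + sum (λ i → fromℕ (ends (class (short i))))
        ≡⟨ cong₂ _+_
             (trans (sum-cong-≗ λ i → trans (cong (fromℕ ∘ ends) (class-long i)) (long-end i))
               (sum-affine (fromℕ 3) (λ i → fromℕ (slot i)) (K + fromℕ 3)))
             (trans (sum-cong-≗ λ i → trans (cong (fromℕ ∘ ends) (class-short i)) (short-end i))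
               (sum-affine (fromℕ 1) (λ i → fromℕ (slot i)) (fromℕ 1))) ⟩
      fromℕ 3 * C + fromℕ n * (K + fromℕ 3) + (fromℕ 1 * C + fromℕ n * fromℕ 1)
        ≡⟨ cong (λ z → fromℕ 3 * C + z * (K + fromℕ 3) + (fromℕ 1 * C + z * fromℕ 1)) (fromℕ-* k m) ⟩
      fromℕ 3 * C + K * M * (K + fromℕ 3) + (fromℕ 1 * C + K * M * fromℕ 1)
        ≡⟨ solve 3 (λ C K M → nat 3 :* C :+ K :* M :* (K :+ nat 3) :+ (nat 1 :* C :+ K :* M :* nat 1)
             := nat 2 :* (nat 2 :* C) :+ K :* M :* (K :+ nat 4)) refl C K M ⟩
      fromℕ 2 * (fromℕ 2 * C) + K * M * (K + fromℕ 4)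
        ≡⟨ cong (λ z → fromℕ 2 * z + K * M * (K + fromℕ 4)) (sum-quotient m k) ⟩
      fromℕ 2 * (M * (K * K - K)) + K * M * (K + fromℕ 4)
        ≡⟨ solve 2 (λ K M → nat 2 :* (M :* (K :* K :- K)) :+ K :* M :* (K :+ nat 4)
             := nat 3 :* (M :* (K :* K)) :+ nat 2 :* (M :* K)) refl K M ⟩
      fromℕ 3 * (M * (K * K)) + fromℕ 2 * (M * K) ∎
      where
      open ≡-Reasoning
      K = fromℕ k
      M = fromℕ m
      C = sum (λ i → fromℕ (slot i))
      long-end : ∀ i → fromℕ (ends (inj₁ i)) ≡ fromℕ 3 * fromℕ (slot i) + (K + fromℕ 3)
      long-end i = begin
        fromℕ (3 ℕ.+ (3 ℕ.* slot i ℕ.+ k))         ≡⟨ fromℕ-+ 3 (3 ℕ.* slot i ℕ.+ k) ⟩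
        fromℕ 3 + fromℕ (3 ℕ.* slot i ℕ.+ k)       ≡⟨ cong (fromℕ 3 +_) (fromℕ-+ (3 ℕ.* slot i) k) ⟩
        fromℕ 3 + (fromℕ (3 ℕ.* slot i) + K)       ≡⟨ cong (λ z → fromℕ 3 + (z + K)) (fromℕ-* 3 (slot i)) ⟩
        fromℕ 3 + (fromℕ 3 * fromℕ (slot i) + K)   ≡⟨ solve 2 (λ x K → nat 3 :+ (nat 3 :* x :+ K) := nat 3 :* x :+ (K :+ nat 3)) refl (fromℕ (slot i)) K ⟩
        fromℕ 3 * fromℕ (slot i) + (K + fromℕ 3)   ∎
      short-end : ∀ i → fromℕ (ends (inj₂ i)) ≡ fromℕ 1 * fromℕ (slot i) + fromℕ 1
      short-end i = trans (fromℕ-+ 1 (slot i))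
        (solve 1 (λ x → nat 1 :+ x := nat 1 :* x :+ nat 1) refl (fromℕ (slot i)))

  -- `IsOPT` asks for an infimum of costs, so no optimal schedule has to be exhibited.
  infimum-exists : (P : Pred ℝ 0ℓ) → ∃ P → ∃ (ℝ-Bounds.LowerBound P) → ∃ (ℝ-Bounds.IsInf P)
  infimum-exists P (x , px) bounded =
    let i , ub , least = complete (ℝ-Bounds.LowerBound P) bounded (x , λ l lb → lb x px) in
    i , (λ y py → least y (λ l lb → lb y py)) , ub

-- From the hard instances to the asymptotic ratio.

module LowerBound (em : ExcludedMiddle 0ℓ) (R : RealNumbers) where

  open Scheduling R
  open OrderedField R
  open Optimum R
  open ExtendedSup em R
  open HardInstances em R
  open OfflineSchedule em R

  module _ {m} .{{_ : NonZero m}} (A : OnlineAlgorithm m) {ρ} (ρ≤40/27 : ρ ≤ frac 40 27) where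

    -- Scaling by `108 = 4 * 27` clears the denominator of 40/27 and the factor 4 of
    -- `separated-cost`. What remains is `480 m k² + 320 m k ≤ 486 m k²`, which holds once
    -- `6 k ≥ 320`; 54 is the first such `k`.
    largeRatio : ∀ k → 54 ℕ.≤ k → ∃[ x ] Ratio A (k ℕ.* m ℕ.+ k ℕ.* m) [ x ] × ρ ≤ x
    largeRatio k 54≤k =
      _ , (hard , opt , isOpt , 0<opt , refl) , *-cancelʳ-≤ 0<opt (≤-trans ρ*opt≤alg (≤-reflexive (sym (÷-* alg 0<opt))))
      where
      hardness = separatingInstance A (k ℕ.* m)
      σ = proj₁ hardness
      open Split (k ℕ.* m) σ
      alg = ALG A hard
      M = fromℕ m
      K = fromℕ k
      Costs : Pred ℝ 0ℓ
      Costs c = Σ (Schedule m (k ℕ.* m ℕ.+ k ℕ.* m)) λ S → Feasible hard S × c ≡ cost hard S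
      3n≤ : ℝ-Bounds.LowerBound Costs (fromℕ 3 * fromℕ (k ℕ.* m))
      3n≤ _ (S , feas , refl) = 3n≤cost {m} {k} σ S feas
      optimal : ∃ (IsOPT m hard)
      optimal = infimum-exists Costs (_ , shortFirst {m} {k} σ , shortFirst-feasible {m} {k} σ , refl) (_ , 3n≤)
      opt = proj₁ optimal
      isOpt = proj₂ optimal
      instance
        k≢0 : NonZero k
        k≢0 = ℕ.>-nonZero (ℕ.≤-trans (s≤s z≤n) 54≤k)
        3km≢0 : NonZero (3 ℕ.* (k ℕ.* m))
        3km≢0 = ℕ.m*n≢0 3 (k ℕ.* m) {{_}} {{ℕ.m*n≢0 k m}}
      0<opt : 0# < opt
      0<opt = <-≤-trans (subst (0# <_) (fromℕ-* 3 (k ℕ.* m)) (0<fromℕ (3 ℕ.* (k ℕ.* m)))) (proj₂ isOpt _ 3n≤)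
      open ≤-Reasoning
      0≤MK : 0# ≤ M * K
      0≤MK = *-nonNeg (0≤fromℕ m) (0≤fromℕ k)
      ρ*opt≤alg : ρ * opt ≤ alg
      ρ*opt≤alg = *-cancelʳ-≤ (0<fromℕ 108) $ begin
        ρ * opt * fromℕ 108
          ≡⟨ solve 2 (λ ρ o → ρ :* o :* nat 108 := nat 4 :* o :* (ρ :* nat 27)) refl ρ opt ⟩
        fromℕ 4 * opt * (ρ * fromℕ 27)
          ≤⟨ *-monoʳ-≤ (*-nonNeg (0≤fromℕ 4) (proj₁ 0<opt)) (≤frac⁻ 40 27 ρ≤40/27) ⟩
        fromℕ 4 * opt * fromℕ 40
          ≡⟨ solve 1 (λ o → nat 4 :* o :* nat 40 := nat 160 :* o) refl opt ⟩
        fromℕ 160 * opt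
          ≤⟨ *-monoʳ-≤ (0≤fromℕ 160) (proj₁ isOpt _ (shortFirst {m} {k} σ , shortFirst-feasible {m} {k} σ , refl)) ⟩
        fromℕ 160 * cost hard (shortFirst {m} {k} σ)
          ≡⟨ cong (fromℕ 160 *_) (shortFirst-cost {m} {k} σ) ⟩
        fromℕ 160 * (fromℕ 3 * (M * (K * K)) + fromℕ 2 * (M * K))
          ≤⟨ ≤-by (fromℕ 6 * ((M * K) * (K - fromℕ 54)) + fromℕ 4 * (M * K))
               (+-nonNeg (*-nonNeg (0≤fromℕ 6) (*-nonNeg 0≤MK (x≤y⇒0≤y-x (fromℕ-mono-≤ 54≤k))))
                 (*-nonNeg (0≤fromℕ 4) 0≤MK))
               (solve 2 (λ M K → nat 160 :* (nat 3 :* (M :* (K :* K)) :+ nat 2 :* (M :* K))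
                 :+ (nat 6 :* ((M :* K) :* (K :- nat 54)) :+ nat 4 :* (M :* K))
                 := nat 27 :* (nat 18 :* (M :* (K :* K)))) refl M K) ⟩
        fromℕ 27 * (fromℕ 18 * (M * (K * K)))
          ≤⟨ *-monoʳ-≤ (0≤fromℕ 27) (separated-cost {m} {k} σ (run A hard) (feasible A hard) (proj₂ (proj₂ hardness))) ⟩
        fromℕ 27 * (fromℕ 4 * alg)
          ≡⟨ solve 1 (λ a → nat 27 :* (nat 4 :* a) := a :* nat 108) refl alg ⟩
        alg * fromℕ 108 ∎

    asymptoticRatio : ∃[ L ] IsAsymptoticRatio A L × [ ρ ] ≤± L
    asymptoticRatio = proj₁ limsup
      , ((λ N → proj₁ (sup N)) , (λ N → proj₂ (sup N)) , (λ n → proj₁ (tail n)) , (λ n → proj₂ (tail n)) , proj₂ limsup)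
      , proj₂ (proj₂ limsup) [ ρ ] λ { _ (n , refl) → ρ≤tail n }
      where
      sup : ∀ N → ∃ (ℝ±-Bounds.IsSup (Ratio A N))
      sup N = supremum (Ratio A N)
      tail : ∀ n → ∃ (ℝ±-Bounds.IsSup λ x → ∃[ N ] n ℕ.≤ N × x ≡ proj₁ (sup N))
      tail n = supremum _
      limsup : ∃ (ℝ±-Bounds.IsInf λ x → ∃[ n ] x ≡ proj₁ (tail n))
      limsup = infimum _
      ρ≤tail : ∀ n → [ ρ ] ≤± proj₁ (tail n)
      ρ≤tail n = ≤±-trans _≤_ ≤-trans [ ρ≤x ] (≤±-trans _≤_ ≤-trans
          (proj₁ (proj₂ (sup N)) [ x ] x∈) (proj₁ (proj₂ (tail n)) _ (N , n≤N , refl)))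
        where
        -- Large enough for `largeRatio`, and since `m` is positive also for `n ≤ N`; so every tail
        -- contains a ratio of at least `ρ`.
        k = 54 ℕ.+ n
        N = k ℕ.* m ℕ.+ k ℕ.* m
        large = largeRatio k (ℕ.m≤m+n 54 n)
        x = proj₁ large
        x∈ = proj₁ (proj₂ large)
        ρ≤x = proj₂ (proj₂ large)
        n≤N : n ℕ.≤ N
        n≤N = ℕ.≤-trans (ℕ.m≤n+m n 54) (ℕ.≤-trans (ℕ.m≤m*n k m) (ℕ.m≤m+n (k ℕ.* m) (k ℕ.* m)))

theorem4p1 :
    ExcludedMiddle 0ℓ → (R : RealNumbers) →
    let open Scheduling R in
    ∃[ ρ ] Isρ ρ
         × frac 14811 10000 ≤ ρ
         -- the maximiser agrees with (0.1939 , 0.2873) to four decimals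
         × (∃[ α ] ∃[ β ] Region α β × F α β ≡ ρ
              × frac 19385 100000 ≤ α × α ≤ frac 19395 100000
              × frac 28725 100000 ≤ β × β ≤ frac 28735 100000)
         × (∀ (m : ℕ) .{{_ : NonZero m}} (A : OnlineAlgorithm m) →
              ∃[ L ] IsAsymptoticRatio A L × [ ρ ] ≤± L)
theorem4p1 em R =
  let ρ , isρ , ρ≥ , maximiser , ρ≤40/27 = Optimum.optimum R in
  ρ , isρ , ρ≥ , maximiser , λ m A → LowerBound.asymptoticRatio em R A ρ≤40/27
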